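{- Every non-collinear visibility graph with minimum degree $\delta$ has vertex-connectivity at least $\frac{\delta}{2}+1$.
   Context: For a finite set $P$ of points in the plane, two distinct points $v,w$ are visible with respect to $P$ if no point of $P$ lies in the open line segment $vw$. The visibility graph of $P$ has vertex set $P$, with $v,w$ adjacent iff they are visible with respect to $P$. A visibility graph is non-collinear if $P$ does not lie on a single line. -}

module Defs where

open import Level using (0ℓ)
open import Data.Nat as ℕ using (ℕ; _<_; _≤_; _*_) renaming (_+_ to _+ℕ_)
open import Data.Fin using (Fin)
open import Data.Fin.Subset using (Subset; _∈_; _∉_; ∣_∣)
open import Data.Sum using (_⊎_)
open import Data.Product using (Σ; ∃; ∃-syntax; _×_; _,_)
open import Relation.Nullary using (¬_)
open import Relation.Binary.PropositionalEquality using (_≡_; _≢_)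
open import Relation.Binary.Structures using (IsStrictTotalOrder)
open import Algebra.Structures using (IsCommutativeRing)
open import Function.Definitions using (Injective)

-- The real numbers, given axiomatically as a complete ordered field.
-- (Any two complete ordered fields are isomorphic, so quantifying over
-- all such structures is the same as speaking about ℝ.)

record RealField : Set₁ where
  infixl 6 _+_ _-_
  infixl 7 _·_
  infix  4 _<ᵣ_
  field
    Carrier  : Set
    _+_ _·_  : Carrier → Carrier → Carrier
    -ᵣ_      : Carrier → Carrier
    0ᵣ 1ᵣ    : Carrier
    _<ᵣ_     : Carrier → Carrier → Set
    isCommutativeRing : IsCommutativeRing _≡_ _+_ _·_ -ᵣ_ 0ᵣ 1ᵣ
    0≢1      : 0ᵣ ≢ 1ᵣ
    inverse  : ∀ x → x ≢ 0ᵣ → ∃[ y ] (x · y ≡ 1ᵣ)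
    isStrictTotalOrder : IsStrictTotalOrder _≡_ _<ᵣ_
    +-mono-< : ∀ {x y} z → x <ᵣ y → x + z <ᵣ y + z
    ·-pos    : ∀ {x y} → 0ᵣ <ᵣ x → 0ᵣ <ᵣ y → 0ᵣ <ᵣ x · y

  field
    completeness : (S : Carrier → Set) → ∃ S →
      ∃[ b ] (∀ x → S x → x <ᵣ b ⊎ x ≡ b) →
      ∃[ s ] ((∀ x → S x → x <ᵣ s ⊎ x ≡ s) ×
              (∀ b → (∀ x → S x → x <ᵣ b ⊎ x ≡ b) → s <ᵣ b ⊎ s ≡ b))

  _-_ : Carrier → Carrier → Carrier
  x - y = x + (-ᵣ y)

module Plane (R : RealField) where
  open RealField R

  Point : Set
  Point = Carrier × Carrier

  InOpenSegment : Point → Point → Point → Set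
  InOpenSegment (vx , vy) (wx , wy) (zx , zy) =
    ∃[ t ] (0ᵣ <ᵣ t × t <ᵣ 1ᵣ ×
            zx ≡ vx + t · (wx - vx) × zy ≡ vy + t · (wy - vy))

  -- a point set P = {p 0, …, p (n-1)} with the points pairwise distinct
  module PointSet {n : ℕ} (p : Fin n → Point) where

    Visible : Fin n → Fin n → Set
    Visible i j = ¬ (∃[ k ] InOpenSegment (p i) (p j) (p k))

    Adj : Fin n → Fin n → Set
    Adj i j = i ≢ j × Visible i j

    Collinear : Set
    Collinear = ∃[ a ] ∃[ b ] ∃[ c ] (¬ (a ≡ 0ᵣ × b ≡ 0ᵣ) ×
                  (∀ k → let (x , y) = p k in a · x + b · y ≡ c))

    MinDegree≥ : ℕ → Set
    MinDegree≥ δ = ∀ i → Σ (Fin δ → Fin n) λ f → Injective _≡_ _≡_ f × (∀ r → Adj i (f r))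

    data WalkAvoiding (S : Subset n) : Fin n → Fin n → Set where
      here : ∀ {i} → WalkAvoiding S i i
      step : ∀ {i j k} → Adj i j → j ∉ S → WalkAvoiding S j k → WalkAvoiding S i k

    ConnectedAvoiding : Subset n → Set
    ConnectedAvoiding S = ∀ i j → i ∉ S → j ∉ S → WalkAvoiding S i j

    KConnected : ℕ → Set
    KConnected k = k < n × (∀ (S : Subset n) → ∣ S ∣ < k → ConnectedAvoiding S)

    ConnectivityAtLeastHalfPlusOne : ℕ → Set
    ConnectivityAtLeastHalfPlusOne δ = ∃[ κ ] (δ +ℕ 2 ≤ 2 * κ × KConnected κ)

{-# OPTIONS --safe #-}

-- Suppose S separates the graph, colour the remaining points Q by whether they lie in a
-- given component of the complement, and note that every bichromatic segment meets S in
-- its interior. The heart is that if Q is not collinear and has at least k ≥ 1 points of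
-- each colour then |S| ≥ k + 1; as a vertex of the minority colour sees only that colour
-- and S, this gives δ + 2 ≤ 2 |S|.
--
-- For the lower bound, induct on |Q|, first deleting points until both colours have k
-- points. Some line then cuts Q into two smaller balanced parts (sweep the pencils of
-- lines passing just on either side of an extreme point). If neither part is collinear,
-- the blockers in the two half-planes are disjoint and we gain one in each. If a part K
-- lies on a line ℓ, rotate the cut about a point of ℓ until it meets a point t of the
-- other part off ℓ: the k′ segments from t to the points of K of the other colour need k′
-- blockers, disjoint from those on ℓ and from those inside the other part. If both parts
-- are collinear, first move one point of K across. When Q itself is collinear, an extreme
-- point of Q gives δ ≤ |S|, and |S| ≥ 2.
module Submission where

open import Defs
open import Algebra.Bundles using (CommutativeMonoid; CommutativeRing; RawRing)
import Algebra.Properties.CommutativeSemigroup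
import Algebra.Properties.Ring
import Algebra.Properties.Semiring.Mult
import Algebra.Solver.Ring
open import Algebra.Solver.Ring.AlmostCommutativeRing using (fromCommutativeRing; _-Raw-AlmostCommutative⟶_)
open import Algebra.Structures using (IsCommutativeRing)
open import Data.Bool as Bool using (Bool; true; false; T; _∧_; not; if_then_else_)
import Data.Bool.Properties as Bool
open import Data.Empty using (⊥-elim)
open import Data.Fin as Fin using (Fin; zero; suc)
import Data.Fin.Properties as Fin
import Data.Fin.Subset as Subset
open import Data.Maybe using (Maybe; just; nothing)
open import Data.Nat as ℕ using (ℕ; zero; suc; s≤s; z≤n)
import Data.Nat.Properties as ℕ
open import Data.Product using (∃-syntax; _×_; _,_; proj₁; proj₂)
open import Data.Sum as Sum using (_⊎_; inj₁; inj₂)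
open import Data.Vec using (lookup; []; _∷_)
open import Data.Vec.Properties using (lookup⇒[]=; []=⇒lookup)
open import Function using (_∘_; id)
open import Function.Bundles using (Equivalence)
open import Function.Definitions using (Injective)
open import Level using (0ℓ)
open import Relation.Binary.Definitions using (Tri; tri<; tri≈; tri>)
open import Relation.Binary.PropositionalEquality
  using (_≡_; _≢_; refl; sym; trans; cong; cong₂; subst; subst₂; module ≡-Reasoning)
open import Relation.Binary.Structures using (IsStrictTotalOrder)
open import Relation.Nullary using (¬_; Dec; yes; no; contradiction)
open import Relation.Nullary.Decidable
  using (⌊_⌋; map′; _×-dec_; ¬?; decidable-stable; toWitness; fromWitness)

-- The surplus in k + 1 comes from Q not being collinear: on a line with the two colours apart, one
-- blocker serves for every k. A collinear part of a cut is therefore out of reach of the induction,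
-- and this obstacle shapes the case analysis. The fan from t makes up for it: its k′ blockers are
-- off ℓ, and K needs a further one on ℓ, so a collinear part still contributes k′ + 1. Only when
-- both parts are collinear does the other part fail to contribute its share, being sure of just one
-- blocker. Moving a point across makes that part non-collinear and costs K at most one point of a
-- colour, which leaves exactly the total required; if it fails in both directions, all of Q is on
-- one line. A cut must be proper as well as balanced. Setting the extreme point v aside leaves the
-- other colour one ahead, and a half-plane with a surplus of one point of that colour is balanced
-- by adding v. Several points may share a line through v, so the swept lines pass beside v and
-- split such groups; the two senses of rotation are there to keep some point beyond the cut.

open Algebra.Properties.CommutativeSemigroup ℕ.+-commutativeSemigroup using () renaming (interchange to ℕ-interchange)

-- Finite sets of indices and their cardinalities

FinSet : ℕ → Set
FinSet n = Fin n → Bool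

infix  4 _∈_ _⊆_
infixr 7 _∩_
infixl 6 _∖_

record _∈_ {n} (i : Fin n) (P : FinSet n) : Set where
  constructor mem
  field holds : T (P i)

open _∈_ public

_⊆_ : ∀ {n} → FinSet n → FinSet n → Set
P ⊆ Q = ∀ i → i ∈ P → i ∈ Q

_∩_ : ∀ {n} → FinSet n → FinSet n → FinSet n
(P ∩ Q) i = P i ∧ Q i

∁ : ∀ {n} → FinSet n → FinSet n
∁ P i = not (P i)

⁅_⁆ : ∀ {n} → Fin n → FinSet n
⁅ i ⁆ j = ⌊ j Fin.≟ i ⌋

_∖_ : ∀ {n} → FinSet n → Fin n → FinSet n
P ∖ i = P ∩ ∁ ⁅ i ⁆

∩⁺ : ∀ {n} {P Q : FinSet n} {i} → i ∈ P → i ∈ Q → i ∈ P ∩ Q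
∩⁺ (mem p) (mem q) = mem (Equivalence.from Bool.T-∧ (p , q))

∩⁻ : ∀ {n} {P Q : FinSet n} {i} → i ∈ P ∩ Q → i ∈ P × i ∈ Q
∩⁻ (mem pq) with Equivalence.to Bool.T-∧ pq
... | p , q = mem p , mem q

∁⁺ : ∀ {n} {P : FinSet n} {i} → ¬ i ∈ P → i ∈ ∁ P
∁⁺ {P = P} {i} ∉P = mem (lemma (P i) (∉P ∘ mem))
  where
  lemma : ∀ b → ¬ T b → T (not b)
  lemma true  ¬b = ¬b _
  lemma false ¬b = _

∁⁻ : ∀ {n} {P : FinSet n} {i} → i ∈ ∁ P → ¬ i ∈ P
∁⁻ {P = P} {i} (mem ∈∁P) (mem ∈P) = lemma (P i) ∈∁P ∈P
  where
  lemma : ∀ b → T (not b) → ¬ T b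
  lemma false _ ()

⁅⁆⁺ : ∀ {n} {i j : Fin n} → j ≡ i → j ∈ ⁅ i ⁆
⁅⁆⁺ eq = mem (fromWitness eq)

⁅⁆⁻ : ∀ {n} {i j : Fin n} → j ∈ ⁅ i ⁆ → j ≡ i
⁅⁆⁻ (mem e) = toWitness e

∖⁺ : ∀ {n} {P : FinSet n} {i j} → j ∈ P → j ≢ i → j ∈ P ∖ i
∖⁺ ∈P j≢i = ∩⁺ ∈P (∁⁺ (j≢i ∘ ⁅⁆⁻))

∖⁻ : ∀ {n} {P : FinSet n} {i j} → j ∈ P ∖ i → j ∈ P × j ≢ i
∖⁻ ∈P∖i with ∩⁻ ∈P∖i
... | ∈P , ∉i = ∈P , ∁⁻ ∉i ∘ ⁅⁆⁺

_∈?_ : ∀ {n} (i : Fin n) (P : FinSet n) → Dec (i ∈ P)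
i ∈? P = map′ mem holds (Bool.T? (P i))

bit : Bool → ℕ
bit b = if b then 1 else 0

count : ∀ {n} → FinSet n → ℕ
count {zero}  P = 0
count {suc n} P = bit (P zero) ℕ.+ count (P ∘ suc)

bit-mono : ∀ a b → (T a → T b) → bit a ℕ.≤ bit b
bit-mono true  true  _ = ℕ.≤-refl
bit-mono true  false f = ⊥-elim (f _)
bit-mono false b     _ = z≤n

bit-split : ∀ a b → bit a ≡ bit (a ∧ b) ℕ.+ bit (a ∧ not b)
bit-split false _     = refl
bit-split true  true  = refl
bit-split true  false = refl

count-⊆ : ∀ {n} {P Q : FinSet n} → P ⊆ Q → count P ℕ.≤ count Q
count-⊆ {zero}          P⊆Q = z≤n
count-⊆ {suc n} {P} {Q} P⊆Q =
  ℕ.+-mono-≤ (bit-mono (P zero) (Q zero) (holds ∘ P⊆Q zero ∘ mem))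
             (count-⊆ {P = P ∘ suc} {Q ∘ suc} (λ i → mem ∘ holds ∘ P⊆Q (suc i) ∘ mem ∘ holds))

count-≐ : ∀ {n} {P Q : FinSet n} → P ⊆ Q → Q ⊆ P → count P ≡ count Q
count-≐ P⊆Q Q⊆P = ℕ.≤-antisym (count-⊆ P⊆Q) (count-⊆ Q⊆P)

count-split : ∀ {n} (P Q : FinSet n) → count P ≡ count (P ∩ Q) ℕ.+ count (P ∩ ∁ Q)
count-split {zero}  P Q = refl
count-split {suc n} P Q = trans
  (cong₂ ℕ._+_ (bit-split (P zero) (Q zero)) (count-split (P ∘ suc) (Q ∘ suc)))
  (ℕ-interchange (bit (P zero ∧ Q zero)) _ _ _)

count-∅ : ∀ {n} (P : FinSet n) → (∀ i → ¬ i ∈ P) → count P ≡ 0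
count-∅ {zero}  P _  = refl
count-∅ {suc n} P ∉P with P zero in eq
... | true  = ⊥-elim (∉P zero (mem (subst T (sym eq) _)))
... | false = count-∅ (P ∘ suc) (λ i → ∉P (suc i) ∘ mem ∘ holds)

count-⁅⁆ : ∀ {n} (i : Fin n) → count ⁅ i ⁆ ≡ 1
count-⁅⁆ {suc n} zero = cong suc (count-∅ {n} (⁅ zero ⁆ ∘ suc) λ { j (mem ()) })
count-⁅⁆ {suc n} (suc i) = trans (count-≐ {n} {⁅ suc i ⁆ ∘ suc} {⁅ i ⁆} ⊆⁅i⁆ ⁅i⁆⊆) (count-⁅⁆ i)
  where
  ⊆⁅i⁆ : ⁅ suc i ⁆ ∘ suc ⊆ ⁅ i ⁆
  ⊆⁅i⁆ j (mem e) = ⁅⁆⁺ (Fin.suc-injective (toWitness {a? = suc j Fin.≟ suc i} e))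
  ⁅i⁆⊆ : ⁅ i ⁆ ⊆ ⁅ suc i ⁆ ∘ suc
  ⁅i⁆⊆ j e = mem (fromWitness {a? = suc j Fin.≟ suc i} (cong suc (⁅⁆⁻ e)))

count-∖ : ∀ {n} {P : FinSet n} {i} → i ∈ P → count P ≡ suc (count (P ∖ i))
count-∖ {P = P} {i} i∈P = trans (count-split P ⁅ i ⁆)
  (cong (ℕ._+ count (P ∖ i)) (trans (count-≐ (λ j → proj₂ ∘ ∩⁻) i⊆) (count-⁅⁆ i)))
  where
  i⊆ : ⁅ i ⁆ ⊆ P ∩ ⁅ i ⁆
  i⊆ j e = ∩⁺ (subst (_∈ P) (sym (⁅⁆⁻ e)) i∈P) e

∈⇒0<count : ∀ {n} {P : FinSet n} {i} → i ∈ P → 0 ℕ.< count P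
∈⇒0<count i∈P = subst (0 ℕ.<_) (sym (count-∖ i∈P)) (s≤s z≤n)

0<count⇒∈ : ∀ {n} (P : FinSet n) → 0 ℕ.< count P → ∃[ i ] i ∈ P
0<count⇒∈ {suc n} P 0<c with P zero in eq
... | true  = zero , mem (subst T (sym eq) _)
... | false with 0<count⇒∈ (P ∘ suc) 0<c
...   | i , mem i∈P = suc i , mem i∈P

-- The partner found for an element is struck from `Q`, which is harmless because by `inj` no other
-- element is related to it. A relation takes the place of an injection since a blocker on a segment
-- is only known to exist.
pigeonhole : ∀ {m n} (P : FinSet m) (Q : FinSet n) (R : Fin m → Fin n → Set) →
  (∀ i → i ∈ P → ∃[ j ] j ∈ Q × R i j) →
  (∀ {i i′ j} → i ∈ P → i′ ∈ P → R i j → R i′ j → i ≡ i′) → count P ℕ.≤ count Q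
pigeonhole {zero}  P Q R total inj = z≤n
pigeonhole {suc m} P Q R total inj with P zero in eq
... | false = pigeonhole (P ∘ suc) Q (R ∘ suc) (λ i → total (suc i) ∘ mem ∘ holds)
                λ (mem p) (mem p′) r r′ → Fin.suc-injective (inj (mem p) (mem p′) r r′)
... | true with total zero (mem (subst T (sym eq) _))
...   | j , j∈Q , r = subst (suc (count (P ∘ suc)) ℕ.≤_) (sym (count-∖ j∈Q))
        (s≤s (pigeonhole (P ∘ suc) (Q ∖ j) (R ∘ suc) total′
          λ (mem p) (mem p′) r r′ → Fin.suc-injective (inj (mem p) (mem p′) r r′)))
  where
  total′ : ∀ i → i ∈ P ∘ suc → ∃[ j′ ] j′ ∈ Q ∖ j × R (suc i) j′
  total′ i (mem i∈P) with total (suc i) (mem i∈P)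
  ... | j′ , j′∈Q , r′ = j′ , ∖⁺ j′∈Q j′≢j , r′
    where
    j′≢j : j′ ≢ j
    j′≢j refl with inj (mem (subst T (sym eq) _)) (mem i∈P) r r′
    ... | ()

forall? : ∀ {n} (P : FinSet n) {F : Fin n → Set} → (∀ i → Dec (F i)) →
  (∀ i → i ∈ P → F i) ⊎ (∃[ i ] i ∈ P × ¬ F i)
forall? {zero}  P F? = inj₁ λ ()
forall? {suc n} P F? with forall? (P ∘ suc) (F? ∘ suc)
... | inj₂ (i , mem i∈P , ¬f) = inj₂ (suc i , mem i∈P , ¬f)
... | inj₁ all with zero ∈? P | F? zero
...   | yes p | no ¬f = inj₂ (zero , p , ¬f)
...   | yes p | yes f = inj₁ λ { zero _ → f ; (suc i) (mem p) → all i (mem p) }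
...   | no ¬p | _     = inj₁ λ { zero p → ⊥-elim (¬p p) ; (suc i) (mem p) → all i (mem p) }

-- Commutative-ring identities in the axiomatic field

module Arithmetic (R : RealField) where
  open RealField R public
  open IsCommutativeRing isCommutativeRing public
    using (+-identityˡ; +-identityʳ; -‿inverseʳ; *-identityˡ; *-identityʳ; zeroˡ; zeroʳ; *-comm; +-comm)
  open IsStrictTotalOrder isStrictTotalOrder public using (compare; _≟_) renaming (trans to <-trans; irrefl to <-irrefl)

  commutativeRing : CommutativeRing 0ℓ 0ℓ
  commutativeRing = record { isCommutativeRing = isCommutativeRing }

  open Algebra.Properties.Ring (CommutativeRing.ring commutativeRing) public
    using (-0#≈0#; +-cancelˡ; x≈y⇒x∙y⁻¹≈ε; x∙y⁻¹≈ε⇒x≈y)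

  -- Formal differences of naturals serve as solver coefficients, so that the
  -- solver can recognise cancellation in an abstract ring.
  module Solver where
    open CommutativeRing commutativeRing using (ring; semiring; distribʳ; +-commutativeMonoid)
    open CommutativeMonoid +-commutativeMonoid using (commutativeSemigroup)
    open Algebra.Properties.CommutativeSemigroup commutativeSemigroup using (interchange)
    open Algebra.Properties.Ring ring hiding (-0#≈0#)
    open Algebra.Properties.Semiring.Mult semiring using (×1-homo-*; ×-homo-+) renaming (_×_ to _×′_)
    open ≡-Reasoning

    -- Normalisation makes equal coefficients syntactically equal.
    normalise : ℕ × ℕ → ℕ × ℕ
    normalise (a , b) = a ℕ.∸ b , b ℕ.∸ a

    differences : RawRing 0ℓ 0ℓ
    differences = record
      { Carrier = ℕ × ℕ
      ; _≈_     = _≡_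
      ; _+_     = λ (a , b) (c , d) → normalise (a ℕ.+ c , b ℕ.+ d)
      ; _*_     = λ (a , b) (c , d) → normalise (a ℕ.* c ℕ.+ b ℕ.* d , a ℕ.* d ℕ.+ b ℕ.* c)
      ; -_      = λ (a , b) → b , a
      ; 0#      = 0 , 0
      ; 1#      = 1 , 0
      }

    ⟦_⟧′ : ℕ × ℕ → Carrier
    ⟦ a , b ⟧′ = a ×′ 1ᵣ - b ×′ 1ᵣ

    minus-+ : ∀ a b c d → (a + c) - (b + d) ≡ (a - b) + (c - d)
    minus-+ a b c d = trans (cong ((a + c) +_) (sym (-‿+-comm b d))) (interchange a c (-ᵣ b) (-ᵣ d))

    minus-* : ∀ a b c d → (a · c + b · d) - (a · d + b · c) ≡ (a - b) · (c - d)
    minus-* a b c d = begin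
      (a · c + b · d) - (a · d + b · c)           ≡⟨ minus-+ (a · c) (a · d) (b · d) (b · c) ⟩
      (a · c - a · d) + (b · d - b · c)           ≡⟨ cong₂ _+_ (sym (x[y-z]≈xy-xz a c d)) lemma ⟩
      a · (c - d) + (-ᵣ b) · (c - d)              ≡⟨ sym (distribʳ (c - d) a (-ᵣ b)) ⟩
      (a - b) · (c - d)                           ∎
      where
      lemma : b · d - b · c ≡ (-ᵣ b) · (c - d)
      lemma = begin
        b · d - b · c                    ≡⟨ +-comm (b · d) _ ⟩
        -ᵣ (b · c) + b · d               ≡⟨ cong₂ _+_ (-‿distribˡ-* b c) (sym (-‿involutive (b · d))) ⟩
        (-ᵣ b) · c + -ᵣ (-ᵣ (b · d))     ≡⟨ cong (λ x → (-ᵣ b) · c + -ᵣ x) (-‿distribˡ-* b d) ⟩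
        (-ᵣ b) · c - (-ᵣ b) · d          ≡⟨ sym (x[y-z]≈xy-xz (-ᵣ b) c d) ⟩
        (-ᵣ b) · (c - d)                 ∎

    embed-≡ : ∀ a b c d → a ℕ.+ d ≡ c ℕ.+ b → ⟦ a , b ⟧′ ≡ ⟦ c , d ⟧′
    embed-≡ a b c d eq = begin
      A - B                   ≡⟨ sym (+-identityʳ _) ⟩
      (A - B) + 0ᵣ            ≡⟨ cong ((A - B) +_) (sym (-‿inverseʳ D)) ⟩
      (A - B) + (D - D)       ≡⟨ sym (minus-+ A B D D) ⟩
      (A + D) - (B + D)       ≡⟨ cong₂ _-_ A+D (+-comm B D) ⟩
      (C + B) - (D + B)       ≡⟨ minus-+ C D B B ⟩
      (C - D) + (B - B)       ≡⟨ cong ((C - D) +_) (-‿inverseʳ B) ⟩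
      (C - D) + 0ᵣ            ≡⟨ +-identityʳ _ ⟩
      C - D                   ∎
      where
      A = a ×′ 1ᵣ
      B = b ×′ 1ᵣ
      C = c ×′ 1ᵣ
      D = d ×′ 1ᵣ
      A+D : A + D ≡ C + B
      A+D = trans (sym (×-homo-+ 1ᵣ a d)) (trans (cong (_×′ 1ᵣ) eq) (×-homo-+ 1ᵣ c b))

    embed-normalise : ∀ x → ⟦ normalise x ⟧′ ≡ ⟦ x ⟧′
    embed-normalise (a , b) = embed-≡ (a ℕ.∸ b) (b ℕ.∸ a) a b (balance a b)
      where
      balance : ∀ a b → a ℕ.∸ b ℕ.+ b ≡ a ℕ.+ (b ℕ.∸ a)
      balance zero    zero    = refl
      balance zero    (suc b) = refl
      balance (suc a) zero    = refl
      balance (suc a) (suc b) = trans (ℕ.+-suc (a ℕ.∸ b) b) (cong suc (balance a b))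

    embed-+ : ∀ x y → ⟦ RawRing._+_ differences x y ⟧′ ≡ ⟦ x ⟧′ + ⟦ y ⟧′
    embed-+ (a , b) (c , d) = trans (embed-normalise (a ℕ.+ c , b ℕ.+ d)) (trans
      (cong₂ _-_ (×-homo-+ 1ᵣ a c) (×-homo-+ 1ᵣ b d)) (minus-+ (a ×′ 1ᵣ) (b ×′ 1ᵣ) (c ×′ 1ᵣ) (d ×′ 1ᵣ)))

    embed-* : ∀ x y → ⟦ RawRing._*_ differences x y ⟧′ ≡ ⟦ x ⟧′ · ⟦ y ⟧′
    embed-* (a , b) (c , d) = trans (embed-normalise (a ℕ.* c ℕ.+ b ℕ.* d , a ℕ.* d ℕ.+ b ℕ.* c)) (trans
      (cong₂ _-_ (lemma a c b d) (lemma a d b c)) (minus-* (a ×′ 1ᵣ) (b ×′ 1ᵣ) (c ×′ 1ᵣ) (d ×′ 1ᵣ)))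
      where
      lemma : ∀ a b c d → (a ℕ.* b ℕ.+ c ℕ.* d) ×′ 1ᵣ ≡ a ×′ 1ᵣ · b ×′ 1ᵣ + c ×′ 1ᵣ · d ×′ 1ᵣ
      lemma a b c d = trans (×-homo-+ 1ᵣ (a ℕ.* b) (c ℕ.* d)) (cong₂ _+_ (×1-homo-* a b) (×1-homo-* c d))

    embedding : differences -Raw-AlmostCommutative⟶ fromCommutativeRing commutativeRing
    embedding = record
      { ⟦_⟧    = ⟦_⟧′
      ; +-homo = embed-+
      ; *-homo = embed-*
      ; -‿homo = λ (a , b) → sym (⁻¹-anti-homo‿- (a ×′ 1ᵣ) (b ×′ 1ᵣ))
      ; 0-homo = -‿inverseʳ 0ᵣ
      ; 1-homo = trans (cong₂ _+_ (+-identityʳ 1ᵣ) -0#≈0#) (+-identityʳ 1ᵣ)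
      }

    weakly≟ : ∀ x y → Maybe (⟦ x ⟧′ ≡ ⟦ y ⟧′)
    weakly≟ (a , b) (c , d) with (a ℕ.+ d) ℕ.≟ (c ℕ.+ b)
    ... | yes eq = just (embed-≡ a b c d eq)
    ... | no  _  = nothing

    open Algebra.Solver.Ring differences (fromCommutativeRing commutativeRing) embedding weakly≟ public
      using (solve; _:=_; _:+_; _:*_; _:-_; :-_)

  open Solver using (solve; _:=_; _:+_; _:*_; _:-_; :-_) public

-- Inequalities, finite extrema and perturbation by a large factor

module OrderedField (R : RealField) where
  open Arithmetic R public

  infix 4 _≤ᵣ_ _<?_

  _≤ᵣ_ : Carrier → Carrier → Set
  x ≤ᵣ y = ¬ y <ᵣ x

  Positive : Carrier → Set
  Positive x = 0ᵣ <ᵣ x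

  _<?_ : ∀ x y → Dec (x <ᵣ y)
  x <? y with compare x y
  ... | tri< x<y _ _ = yes x<y
  ... | tri≈ x≮y _ _ = no x≮y
  ... | tri> x≮y _ _ = no x≮y

  x-0≡x : ∀ x → x - 0ᵣ ≡ x
  x-0≡x x = trans (cong (x +_) -0#≈0#) (+-identityʳ x)

  irrefl : ∀ {x} → ¬ x <ᵣ x
  irrefl = <-irrefl refl

  <⇒≢ : ∀ {x y} → x <ᵣ y → x ≢ y
  <⇒≢ x<x refl = irrefl x<x

  <⇒≤ : ∀ {x y} → x <ᵣ y → x ≤ᵣ y
  <⇒≤ x<y y<x = irrefl (<-trans x<y y<x)

  ≤-<-trans : ∀ {x y z} → x ≤ᵣ y → y <ᵣ z → x <ᵣ z
  ≤-<-trans {x} {y} {z} x≤y y<z with compare x y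
  ... | tri< x<y _ _ = <-trans x<y y<z
  ... | tri≈ _ refl _ = y<z
  ... | tri> _ _ y<x = contradiction y<x x≤y

  ≤∧≢⇒< : ∀ {x y} → x ≤ᵣ y → x ≢ y → x <ᵣ y
  ≤∧≢⇒< {x} {y} x≤y x≢y with compare x y
  ... | tri< x<y _ _ = x<y
  ... | tri≈ _ x≡y _ = contradiction x≡y x≢y
  ... | tri> _ _ y<x = contradiction y<x x≤y

  <⇒0<- : ∀ {x y} → x <ᵣ y → Positive (y - x)
  <⇒0<- {x} {y} x<y = subst (_<ᵣ y - x) (-‿inverseʳ x) (+-mono-< (-ᵣ x) x<y)

  0<-⇒< : ∀ {x y} → Positive (y - x) → x <ᵣ y
  0<-⇒< {x} {y} 0<y-x = subst₂ _<ᵣ_ (+-identityˡ x)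
    (solve 2 (λ x y → (y :- x) :+ x := y) refl x y) (+-mono-< x 0<y-x)

  neg⇒0<- : ∀ {x} → x <ᵣ 0ᵣ → Positive (-ᵣ x)
  neg⇒0<- {x} x<0 = subst Positive (+-identityˡ (-ᵣ x)) (<⇒0<- x<0)

  0<-⇒neg : ∀ {x} → Positive (-ᵣ x) → x <ᵣ 0ᵣ
  0<-⇒neg {x} 0<-x = 0<-⇒< (subst Positive (sym (+-identityˡ (-ᵣ x))) 0<-x)

  pos⇒-<0 : ∀ {x} → Positive x → -ᵣ x <ᵣ 0ᵣ
  pos⇒-<0 {x} 0<x = 0<-⇒neg (subst Positive (solve 1 (λ x → x := :- (:- x)) refl x) 0<x)

  +-pos : ∀ {x y} → Positive x → Positive y → Positive (x + y)
  +-pos {x} {y} 0<x 0<y = <-trans 0<y (subst (_<ᵣ x + y) (+-identityˡ y) (+-mono-< y 0<x))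

  0<1 : Positive 1ᵣ
  0<1 with compare 0ᵣ 1ᵣ
  ... | tri< 0<1 _ _ = 0<1
  ... | tri≈ _ 0≡1 _ = contradiction 0≡1 0≢1
  ... | tri> _ _ 1<0 = subst Positive
    (trans (solve 1 (λ x → :- x :* :- x := x :* x) refl 1ᵣ) (*-identityˡ 1ᵣ))
    (·-pos (neg⇒0<- 1<0) (neg⇒0<- 1<0))

  pos·neg : ∀ {x y} → Positive x → y <ᵣ 0ᵣ → x · y <ᵣ 0ᵣ
  pos·neg {x} {y} 0<x y<0 = 0<-⇒neg
    (subst Positive (solve 2 (λ x y → x :* :- y := :- (x :* y)) refl x y) (·-pos 0<x (neg⇒0<- y<0)))

  pos-cancelˡ : ∀ {x y} → Positive x → Positive (x · y) → Positive y
  pos-cancelˡ {x} {y} 0<x 0<xy with compare 0ᵣ y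
  ... | tri< 0<y _ _ = 0<y
  ... | tri≈ _ refl _ = contradiction (subst Positive (zeroʳ x) 0<xy) irrefl
  ... | tri> _ _ y<0 = contradiction (<-trans 0<xy (pos·neg 0<x y<0)) irrefl

  ≢0⇒0<² : ∀ {x} → x ≢ 0ᵣ → Positive (x · x)
  ≢0⇒0<² {x} x≢0 with compare 0ᵣ x
  ... | tri< 0<x _ _ = ·-pos 0<x 0<x
  ... | tri≈ _ 0≡x _ = contradiction (sym 0≡x) x≢0
  ... | tri> _ _ x<0 = subst Positive (solve 1 (λ x → :- x :* :- x := x :* x) refl x)
    (·-pos (neg⇒0<- x<0) (neg⇒0<- x<0))

  abstract
    -- The default `inv 0ᵣ = 0ᵣ` makes `inv` injective on the whole field. Thus `inv (X at i)` tells
    -- all points apart in a pencil, even v, where `X` vanishes.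
    inv : Carrier → Carrier
    inv x with x ≟ 0ᵣ
    ... | yes _   = 0ᵣ
    ... | no  x≢0 = proj₁ (inverse x x≢0)

    ·-inv : ∀ {x} → x ≢ 0ᵣ → x · inv x ≡ 1ᵣ
    ·-inv {x} x≢0 with x ≟ 0ᵣ
    ... | yes x≡0 = contradiction x≡0 x≢0
    ... | no  x≢0 = proj₂ (inverse x x≢0)

    inv-0 : inv 0ᵣ ≡ 0ᵣ
    inv-0 with 0ᵣ ≟ 0ᵣ
    ... | yes _   = refl
    ... | no  0≢0 = contradiction refl 0≢0

  ·≡0 : ∀ {x y} → x ≢ 0ᵣ → x · y ≡ 0ᵣ → y ≡ 0ᵣ
  ·≡0 {x} {y} x≢0 xy≡0 = begin
    y               ≡⟨ sym (*-identityˡ y) ⟩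
    1ᵣ · y          ≡⟨ cong (_· y) (sym (·-inv x≢0)) ⟩
    x · inv x · y   ≡⟨ solve 3 (λ x i y → x :* i :* y := i :* (x :* y)) refl x (inv x) y ⟩
    inv x · (x · y) ≡⟨ cong (inv x ·_) xy≡0 ⟩
    inv x · 0ᵣ      ≡⟨ zeroʳ (inv x) ⟩
    0ᵣ              ∎
    where open ≡-Reasoning

  inv≢0 : ∀ {x} → x ≢ 0ᵣ → inv x ≢ 0ᵣ
  inv≢0 {x} x≢0 inv≡0 = 0≢1 (trans (sym (zeroʳ x)) (trans (cong (x ·_) (sym inv≡0)) (·-inv x≢0)))

  inv-pos : ∀ {x} → Positive x → Positive (inv x)
  inv-pos {x} 0<x = pos-cancelˡ 0<x (subst Positive (sym (·-inv (<⇒≢ 0<x ∘ sym))) 0<1)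

  inv-injective : ∀ {x y} → inv x ≡ inv y → x ≡ y
  inv-injective {x} {y} eq = by-cases (x ≟ 0ᵣ) (y ≟ 0ᵣ)
    where
    open ≡-Reasoning
    by-cases : Dec (x ≡ 0ᵣ) → Dec (y ≡ 0ᵣ) → x ≡ y
    by-cases (yes x≡0) (yes y≡0) = trans x≡0 (sym y≡0)
    by-cases (yes x≡0) (no y≢0) = contradiction (trans (sym eq) (trans (cong inv x≡0) inv-0)) (inv≢0 y≢0)
    by-cases (no x≢0) (yes y≡0) = contradiction (trans eq (trans (cong inv y≡0) inv-0)) (inv≢0 x≢0)
    by-cases (no x≢0) (no y≢0) = begin
      x               ≡⟨ sym (*-identityʳ x) ⟩
      x · 1ᵣ          ≡⟨ cong (x ·_) (sym (·-inv y≢0)) ⟩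
      x · (y · inv y) ≡⟨ solve 3 (λ x y i → x :* (y :* i) := (x :* i) :* y) refl x y (inv y) ⟩
      x · inv y · y   ≡⟨ cong (λ i → x · i · y) (sym eq) ⟩
      x · inv x · y   ≡⟨ cong (_· y) (·-inv x≢0) ⟩
      1ᵣ · y          ≡⟨ *-identityˡ y ⟩
      y               ∎

  +-nonpos : ∀ {x y} → x ≤ᵣ 0ᵣ → y ≤ᵣ 0ᵣ → x + y ≤ᵣ 0ᵣ
  +-nonpos {x} {y} x≤0 y≤0 0<x+y with compare 0ᵣ x
  ... | tri< 0<x _ _ = x≤0 0<x
  ... | tri≈ _ refl _ = y≤0 (subst Positive (+-identityˡ y) 0<x+y)
  ... | tri> _ _ x<0 = y≤0 (subst Positive (solve 2 (λ x y → (x :+ y) :+ :- x := y) refl x y) (+-pos 0<x+y (neg⇒0<- x<0)))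

  ·-nonpos : ∀ {x y} → Positive x → y ≤ᵣ 0ᵣ → x · y ≤ᵣ 0ᵣ
  ·-nonpos 0<x y≤0 = y≤0 ∘ pos-cancelˡ 0<x

  interpolate-combination : ∀ t a b → a + t · (b - a) ≡ (1ᵣ - t) · a + t · b
  interpolate-combination t a b = trans
    (cong (_+ t · (b - a)) (sym (*-identityˡ a)))
    (solve 4 (λ o t a b → o :* a :+ t :* (b :- a) := (o :- t) :* a :+ t :* b) refl 1ᵣ t a b)

  module Interpolate {t a b : Carrier} (0<t : Positive t) (t<1 : t <ᵣ 1ᵣ) where
    private combination = interpolate-combination t a b

    interpolate-pos : Positive a → Positive b → Positive (a + t · (b - a))
    interpolate-pos 0<a 0<b = subst Positive (sym combination) (+-pos (·-pos (<⇒0<- t<1) 0<a) (·-pos 0<t 0<b))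

    interpolate-nonpos : a ≤ᵣ 0ᵣ → b ≤ᵣ 0ᵣ → a + t · (b - a) ≤ᵣ 0ᵣ
    interpolate-nonpos a≤0 b≤0 = subst (_≤ᵣ 0ᵣ) (sym combination)
      (+-nonpos (·-nonpos (<⇒0<- t<1) a≤0) (·-nonpos 0<t b≤0))

    interpolate-0-pos : a ≡ 0ᵣ → Positive b → Positive (a + t · (b - a))
    interpolate-0-pos refl 0<b = subst Positive
      (sym (trans combination (trans (cong (_+ t · b) (zeroʳ _)) (+-identityˡ (t · b))))) (·-pos 0<t 0<b)

    interpolate-0 : a ≡ 0ᵣ → b ≡ 0ᵣ → a + t · (b - a) ≡ 0ᵣ
    interpolate-0 refl refl = trans combination (trans (cong₂ _+_ (zeroʳ _) (zeroʳ t)) (+-identityʳ 0ᵣ))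

  upper-bound : ∀ {n} (f : Fin n → Carrier) → ∃[ M ] (∀ i → f i <ᵣ M)
  upper-bound {zero}  f = 0ᵣ , λ ()
  upper-bound {suc n} f with upper-bound (f ∘ suc)
  ... | M , bound with f zero <? M
  ...   | yes f<M = M , λ { zero → f<M ; (suc i) → bound i }
  ...   | no  f≮M = f zero + 1ᵣ , λ { zero → f<M′ ; (suc i) → <-trans (bound i) (≤-<-trans f≮M f<M′) }
    where
    f<M′ : f zero <ᵣ f zero + 1ᵣ
    f<M′ = 0<-⇒< (subst Positive (solve 2 (λ f o → o := (f :+ o) :- f) refl (f zero) 1ᵣ) 0<1)

  upper-bound₂ : ∀ {n} (f : Fin n → Fin n → Carrier) → ∃[ M ] (∀ i j → f i j <ᵣ M)
  upper-bound₂ f with upper-bound (λ i → proj₁ (upper-bound (f i)))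
  ... | M , bound = M , λ i j → <-trans (proj₂ (upper-bound (f i)) j) (bound i)

  -- The value of M at which `M · α + β` changes sign, for `α ≢ 0ᵣ`; once M exceeds it, the sign is
  -- that of α.
  ratio : Carrier → Carrier → Carrier
  ratio α β = (-ᵣ β) · inv α

  ratio-identity : ∀ {α β M} → α ≢ 0ᵣ → (M - ratio α β) · α ≡ M · α + β
  ratio-identity {α} {β} {M} α≢0 = begin
    (M - (-ᵣ β) · inv α) · α ≡⟨ solve 4 (λ M b i a → (M :- (:- b) :* i) :* a := M :* a :+ b :* (a :* i)) refl M β (inv α) α ⟩
    M · α + β · (α · inv α)  ≡⟨ cong (λ x → M · α + β · x) (·-inv α≢0) ⟩
    M · α + β · 1ᵣ           ≡⟨ cong (M · α +_) (*-identityʳ β) ⟩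
    M · α + β                ∎
    where open ≡-Reasoning

  -- Scaling α up makes M α + β have the sign of α wherever α ≠ 0.
  dominate-pos : ∀ {α β M} → ratio α β <ᵣ M → Positive α → Positive (M · α + β)
  dominate-pos r<M 0<α = subst Positive (ratio-identity (<⇒≢ 0<α ∘ sym)) (·-pos (<⇒0<- r<M) 0<α)

  dominate-neg : ∀ {α β M} → ratio α β <ᵣ M → α <ᵣ 0ᵣ → M · α + β <ᵣ 0ᵣ
  dominate-neg r<M α<0 = subst (_<ᵣ 0ᵣ) (ratio-identity (<⇒≢ α<0)) (pos·neg (<⇒0<- r<M) α<0)

  -- A key refining the preorder given by α, with ties broken by τ.
  abstract
    refine : ∀ {n} (α τ : Fin n → Carrier) → (∀ {i j} → α i ≡ α j → τ i ≡ τ j → i ≡ j) →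
      ∃[ M ] (∀ {i j} → M · α i + τ i ≡ M · α j + τ j → i ≡ j) ×
             (∀ {i j} → α i <ᵣ α j → M · α i + τ i <ᵣ M · α j + τ j)
    refine α τ joint-inj with upper-bound₂ (λ i j → ratio (α j - α i) (τ j - τ i))
    ... | M , bound = M , inj , mono
      where
      mono : ∀ {i j} → α i <ᵣ α j → M · α i + τ i <ᵣ M · α j + τ j
      mono {i} {j} αi<αj = 0<-⇒< (subst Positive
        (solve 5 (λ M a b c d → M :* (b :- a) :+ (d :- c) := (M :* b :+ d) :- (M :* a :+ c)) refl M (α i) (α j) (τ i) (τ j))
        (dominate-pos (bound i j) (<⇒0<- αi<αj)))
      inj : ∀ {i j} → M · α i + τ i ≡ M · α j + τ j → i ≡ j
      inj {i} {j} eq with compare (α i) (α j)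
      ... | tri< αi<αj _ _ = contradiction eq (<⇒≢ (mono αi<αj))
      ... | tri> _ _ αj<αi = contradiction (sym eq) (<⇒≢ (mono αj<αi))
      ... | tri≈ _ αi≡αj _ = joint-inj αi≡αj (begin
        τ i                       ≡⟨ solve 2 (λ x y → y := (x :+ y) :- x) refl (M · α i) (τ i) ⟩
        (M · α i + τ i) - M · α i ≡⟨ cong₂ (λ x y → x - M · y) eq αi≡αj ⟩
        (M · α j + τ j) - M · α j ≡⟨ solve 2 (λ x y → (x :+ y) :- x := y) refl (M · α j) (τ j) ⟩
        τ j                       ∎)
        where open ≡-Reasoning

  argmin : ∀ {n} (P : FinSet n) (f : Fin n → Carrier) → (∃[ i ] i ∈ P) →
    ∃[ i ] i ∈ P × (∀ j → j ∈ P → f i ≤ᵣ f j)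
  argmin {suc n} P f (k , k∈P) with (0 ℕ.<? count (P ∘ suc)) | zero ∈? P
  ... | no none | _ = k , k∈P , λ j j∈P → subst (λ k → f k ≤ᵣ f j) (trans (only-zero j j∈P) (sym (only-zero k k∈P))) irrefl
    where
    only-zero : ∀ i → i ∈ P → i ≡ zero
    only-zero zero    _       = refl
    only-zero (suc i) (mem p) = contradiction (∈⇒0<count {i = i} (mem p)) none
  ... | yes some | 0∈?P with argmin (P ∘ suc) (f ∘ suc) (0<count⇒∈ _ some)
  ...   | i , mem i∈P , min with 0∈?P | f zero <? f (suc i)
  ...     | yes 0∈P | yes f0<fi = zero , 0∈P , λ { zero _ → irrefl ; (suc j) (mem p) → min j (mem p) ∘ λ lt → <-trans lt f0<fi }
  ...     | yes 0∈P | no  f0≮fi = suc i , mem i∈P , λ { zero _ → f0≮fi ; (suc j) (mem p) → min j (mem p) }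
  ...     | no  0∉P | _         = suc i , mem i∈P , λ { zero 0∈P → contradiction 0∈P 0∉P ; (suc j) (mem p) → min j (mem p) }

-- Affine forms, betweenness and collinearity in the plane

module Geometry (R : RealField) {n : ℕ} (p : Fin n → Plane.Point R) (p-inj : Injective _≡_ _≡_ p) where
  open OrderedField R public
  open Plane R public using (InOpenSegment)

  x y : Fin n → Carrier
  x i = proj₁ (p i)
  y i = proj₂ (p i)

  xy-injective : ∀ {i j} → x i ≡ x j → y i ≡ y j → i ≡ j
  xy-injective xi≡xj yi≡yj = p-inj (cong₂ _,_ xi≡xj yi≡yj)

  -- Lines and half-planes are represented by the zeros and the sign of an affine function. Constant
  -- functions are included, and `Nondegenerate` rules them out where the zero set has to be a line.
  record Form : Set where
    constructor form
    field a b c : Carrier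

  open Form

  infix 8 _at_

  _at_ : Form → Fin n → Carrier
  φ at i = a φ · x i + b φ · y i + c φ

  Nondegenerate : Form → Set
  Nondegenerate φ = ¬ (a φ ≡ 0ᵣ × b φ ≡ 0ᵣ)

  -- With `w = 0ᵣ` these are the lines of the pencil spanned by φ and ψ; a nonzero `w` pushes a line
  -- off their common point.
  combine : Carrier → Form → Carrier → Form → Carrier → Form
  combine u φ v ψ w = form (u · a φ + v · a ψ) (u · b φ + v · b ψ) (u · c φ + v · c ψ + w)

  at-combine : ∀ u φ v ψ w i → combine u φ v ψ w at i ≡ u · φ at i + v · ψ at i + w
  at-combine u (form a b c) v (form a′ b′ c′) w i = solve 11
    (λ u v w a b c a′ b′ c′ x y →
      (u :* a :+ v :* a′) :* x :+ (u :* b :+ v :* b′) :* y :+ (u :* c :+ v :* c′ :+ w) :=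
      u :* (a :* x :+ b :* y :+ c) :+ v :* (a′ :* x :+ b′ :* y :+ c′) :+ w)
    refl u v w a b c a′ b′ c′ (x i) (y i)

  Between : Fin n → Fin n → Fin n → Set
  Between i j k = InOpenSegment (p i) (p j) (p k)

  at-between : ∀ φ {i j k} ((t , _) : Between i j k) → φ at k ≡ φ at i + t · (φ at j - φ at i)
  at-between (form a b c) {i} {j} {k} (t , _ , _ , xk , yk) = trans
    (cong₂ (λ X Y → a · X + b · Y + c) xk yk)
    (solve 8 (λ a b c t xi yi xj yj →
        a :* (xi :+ t :* (xj :- xi)) :+ b :* (yi :+ t :* (yj :- yi)) :+ c :=
        (a :* xi :+ b :* yi :+ c) :+ t :* ((a :* xj :+ b :* yj :+ c) :- (a :* xi :+ b :* yi :+ c)))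
      refl a b c t (x i) (y i) (x j) (y j))

  between-pos : ∀ φ {i j k} → Between i j k → Positive (φ at i) → Positive (φ at j) → Positive (φ at k)
  between-pos φ k∈ij@(_ , 0<t , t<1 , _) 0<φi 0<φj =
    subst Positive (sym (at-between φ k∈ij)) (Interpolate.interpolate-pos 0<t t<1 0<φi 0<φj)

  between-nonpos : ∀ φ {i j k} → Between i j k → φ at i ≤ᵣ 0ᵣ → φ at j ≤ᵣ 0ᵣ → φ at k ≤ᵣ 0ᵣ
  between-nonpos φ k∈ij@(_ , 0<t , t<1 , _) φi≤0 φj≤0 =
    subst (_≤ᵣ 0ᵣ) (sym (at-between φ k∈ij)) (Interpolate.interpolate-nonpos 0<t t<1 φi≤0 φj≤0)

  between-0-pos : ∀ φ {i j k} → Between i j k → φ at i ≡ 0ᵣ → Positive (φ at j) → Positive (φ at k)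
  between-0-pos φ k∈ij@(_ , 0<t , t<1 , _) φi≡0 0<φj =
    subst Positive (sym (at-between φ k∈ij)) (Interpolate.interpolate-0-pos 0<t t<1 φi≡0 0<φj)

  between-0 : ∀ φ {i j k} → Between i j k → φ at i ≡ 0ᵣ → φ at j ≡ 0ᵣ → φ at k ≡ 0ᵣ
  between-0 φ k∈ij@(_ , 0<t , t<1 , _) φi≡0 φj≡0 =
    trans (at-between φ k∈ij) (Interpolate.interpolate-0 0<t t<1 φi≡0 φj≡0)

  at-between-0 : ∀ φ {i j k} ((t , _) : Between i j k) → φ at j ≡ 0ᵣ → φ at k ≡ φ at i - t · φ at i
  at-between-0 φ {i} k∈ij@(t , _) φj≡0 = trans (at-between φ k∈ij)
    (trans (cong (λ z → φ at i + t · (z - φ at i)) φj≡0) (trans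
      (cong (λ z → φ at i + t · z) (+-identityˡ _))
      (solve 2 (λ t f → f :+ t :* :- f := f :- t :* f) refl t (φ at i))))

  between-≢0 : ∀ φ {i j k} → Between i j k → φ at i ≢ 0ᵣ → φ at j ≡ 0ᵣ → φ at k ≢ 0ᵣ
  between-≢0 φ {i} {j} {k} k∈ij@(t , 0<t , t<1 , _) φi≢0 φj≡0 φk≡0 =
    φi≢0 (·≡0 {1ᵣ - t} (<⇒≢ (<⇒0<- t<1) ∘ sym) (begin
      (1ᵣ - t) · φ at i       ≡⟨ solve 3 (λ o t f → (o :- t) :* f := o :* f :- t :* f) refl 1ᵣ t (φ at i) ⟩
      1ᵣ · φ at i - t · φ at i ≡⟨ cong (_- t · φ at i) (*-identityˡ (φ at i)) ⟩
      φ at i - t · φ at i     ≡⟨ sym (at-between-0 φ k∈ij φj≡0) ⟩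
      φ at k                  ≡⟨ φk≡0 ⟩
      0ᵣ                      ∎))
    where open ≡-Reasoning

  -≡0⇒≡ : ∀ {a b} → a - b ≡ 0ᵣ → a ≡ b
  -≡0⇒≡ = x∙y⁻¹≈ε⇒x≈y _ _

  ·-cancelˡ : ∀ {a b c} → a ≢ 0ᵣ → a · b ≡ a · c → b ≡ c
  ·-cancelˡ {a} {b} {c} a≢0 eq = -≡0⇒≡ (·≡0 a≢0 (trans
    (solve 3 (λ a b c → a :* (b :- c) := a :* b :- a :* c) refl a b c) (x≈y⇒x∙y⁻¹≈ε eq)))

  ·-cancelʳ : ∀ {a b c} → a ≢ 0ᵣ → b · a ≡ c · a → b ≡ c
  ·-cancelʳ {a} {b} {c} a≢0 eq = ·-cancelˡ a≢0 (trans (*-comm a b) (trans eq (*-comm c a)))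

  -- The value of φ at k is `1ᵣ - t` times that at i, so k fixes the parameter t, and i, k and t fix
  -- the far end. Hence in the fan from i to the points of a line each blocker serves only one
  -- segment.
  between-fan : ∀ φ {i j j′ k} → φ at i ≢ 0ᵣ → φ at j ≡ 0ᵣ → φ at j′ ≡ 0ᵣ →
    Between i j k → Between i j′ k → j ≡ j′
  between-fan φ {i} {j} {j′} {k} φi≢0 φj≡0 φj′≡0 k∈ij@(t , 0<t , _ , xk , yk) k∈ij′@(t′ , _ , _ , xk′ , yk′) =
    xy-injective (coordinate x (trans (sym xk) xk′)) (coordinate y (trans (sym yk) yk′))
    where
    t≡t′ : t ≡ t′
    t≡t′ = ·-cancelʳ φi≢0 (begin
      t · f               ≡⟨ solve 2 (λ t f → t :* f := f :- (f :- t :* f)) refl t f ⟩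
      f - (f - t · f)     ≡⟨ cong (λ z → f - z) (trans (sym (at-between-0 φ k∈ij φj≡0)) (at-between-0 φ k∈ij′ φj′≡0)) ⟩
      f - (f - t′ · f)    ≡⟨ solve 2 (λ t f → f :- (f :- t :* f) := t :* f) refl t′ f ⟩
      t′ · f              ∎)
      where
      open ≡-Reasoning
      f = φ at i
    coordinate : ∀ (z : Fin n → Carrier) → z i + t · (z j - z i) ≡ z i + t′ · (z j′ - z i) → z j ≡ z j′
    coordinate z eq = -≡0⇒≡ (trans
      (solve 3 (λ a b c → a :- b := (a :- c) :- (b :- c)) refl (z j) (z j′) (z i))
      (x≈y⇒x∙y⁻¹≈ε (·-cancelˡ (<⇒≢ 0<t ∘ sym)
        (trans (+-cancelˡ _ _ _ eq) (cong (λ s → s · (z j′ - z i)) (sym t≡t′))))))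

  between-sym : ∀ {i j k} → Between i j k → Between j i k
  between-sym {i} {j} (t , 0<t , t<1 , xk , yk) = 1ᵣ - t , <⇒0<- t<1 , 1-t<1 , trans xk (flip (x i) (x j)) , trans yk (flip (y i) (y j))
    where
    1-t<1 : 1ᵣ - t <ᵣ 1ᵣ
    1-t<1 = 0<-⇒< (subst Positive (solve 2 (λ o t → t := o :- (o :- t)) refl 1ᵣ t) 0<t)
    flip : ∀ a b → a + t · (b - a) ≡ b + (1ᵣ - t) · (a - b)
    flip a b = trans (cong (_+ t · (b - a)) (solve 2 (λ a b → a := b :+ (a :- b)) refl a b)) (trans
      (cong (λ z → b + z + t · (b - a)) (sym (*-identityˡ (a - b))))
      (solve 4 (λ o t a b → b :+ o :* (a :- b) :+ t :* (b :- a) := b :+ (o :- t) :* (a :- b)) refl 1ᵣ t a b))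

  between-trans : ∀ {i j k l} → Between i j k → Between i k l → Between i j l
  between-trans {i} {j} (t , 0<t , t<1 , xk , yk) (s , 0<s , s<1 , xl , yl) =
    s · t , ·-pos 0<s 0<t , <-trans st<t t<1 , step x xk xl , step y yk yl
    where
    st<t : s · t <ᵣ t
    st<t = 0<-⇒< (subst Positive (trans
      (solve 3 (λ o s t → (o :- s) :* t := o :* t :- s :* t) refl 1ᵣ s t)
      (cong (_- s · t) (*-identityˡ t))) (·-pos (<⇒0<- s<1) 0<t))
    step : ∀ (z : Fin n → Carrier) {k l} → z k ≡ z i + t · (z j - z i) → z l ≡ z i + s · (z k - z i) →
      z l ≡ z i + s · t · (z j - z i)
    step z zk zl = trans zl (trans (cong (λ w → z i + s · (w - z i)) zk)
      (solve 4 (λ a b s t → a :+ s :* ((a :+ t :* (b :- a)) :- a) := a :+ s :* t :* (b :- a)) refl (z i) (z j) s t))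

  abstract
    heights : ∃[ M ] (∀ {i j} → M · x i + y i ≡ M · x j + y j → i ≡ j) ×
                     (∀ {i j} → x i <ᵣ x j → M · x i + y i <ᵣ M · x j + y j)
    heights = refine x y xy-injective

  tilt : Carrier
  tilt = proj₁ heights

  -- A linear function with distinct values at all the points, in place of an assumption of general
  -- position. It yields unique extreme points, breaks ties, recovers the parameter of a point on a
  -- segment and orders the points of a line.
  height : Form
  height = form tilt 1ᵣ 0ᵣ

  at-height : ∀ i → height at i ≡ tilt · x i + y i
  at-height i = trans (+-identityʳ _) (cong (tilt · x i +_) (*-identityˡ (y i)))

  height-injective : ∀ {i j} → height at i ≡ height at j → i ≡ j
  height-injective {i} {j} eq = proj₁ (proj₂ heights) (trans (sym (at-height i)) (trans eq (at-height j)))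

  between-≢ˡ : ∀ {i j k} → i ≢ j → Between i j k → k ≢ i
  between-≢ˡ {i} {j} i≢j k∈ij@(t , 0<t , _) refl = i≢j (sym (height-injective (-≡0⇒≡ (·≡0 (<⇒≢ 0<t ∘ sym)
    (+-cancelˡ _ _ _ (trans (sym (at-between height k∈ij)) (sym (+-identityʳ _))))))))

  between-≢ʳ : ∀ {i j k} → i ≢ j → Between i j k → k ≢ j
  between-≢ʳ i≢j k∈ij = between-≢ˡ (i≢j ∘ sym) (between-sym k∈ij)

  -- Since `height` is affine and differs at i and j, it admits a single candidate for the parameter
  -- t; only the range of t and the two coordinates remain to be tested.
  decide-between : ∀ {i j} → i ≢ j → ∀ k → Dec (Between i j k)
  decide-between {i} {j} i≢j k = map′ (t ,_) forced
    ((0ᵣ <? t) ×-dec (t <? 1ᵣ) ×-dec (x k ≟ x i + t · (x j - x i)) ×-dec (y k ≟ y i + t · (y j - y i)))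
    where
    Δ = height at j - height at i
    t = (height at k - height at i) · inv Δ
    Δ≢0 : Δ ≢ 0ᵣ
    Δ≢0 = i≢j ∘ sym ∘ height-injective ∘ -≡0⇒≡
    forced : ((s , _) : Between i j k) → Positive t × t <ᵣ 1ᵣ × x k ≡ x i + t · (x j - x i) × y k ≡ y i + t · (y j - y i)
    forced k∈ij@(s , rest) = subst (λ s → Positive s × s <ᵣ 1ᵣ × x k ≡ x i + s · (x j - x i) × y k ≡ y i + s · (y j - y i)) s≡t rest
      where
      open ≡-Reasoning
      s≡t : s ≡ t
      s≡t = begin
        s                 ≡⟨ sym (*-identityʳ s) ⟩
        s · 1ᵣ            ≡⟨ cong (s ·_) (sym (·-inv Δ≢0)) ⟩
        s · (Δ · inv Δ)   ≡⟨ solve 4 (λ s d e h → s :* (d :* e) := ((h :+ s :* d) :- h) :* e) refl s Δ (inv Δ) (height at i) ⟩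
        ((height at i + s · Δ) - height at i) · inv Δ ≡⟨ cong (λ z → (z - height at i) · inv Δ) (sym (at-between height k∈ij)) ⟩
        t                 ∎

  abstract
    between? : ∀ {i j} → i ≢ j → ∀ k → Dec (Between i j k)
    between? = decide-between

  -- The level line of `height` through v, which contains no other point and supports any set in
  -- which v is lowest.
  above : Fin n → Form
  above v = form tilt 1ᵣ (-ᵣ (height at v))

  at-above : ∀ v i → above v at i ≡ height at i - height at v
  at-above v i = cong (_- height at v) (sym (+-identityʳ _))

  above-self : ∀ v → above v at v ≡ 0ᵣ
  above-self v = trans (at-above v v) (-‿inverseʳ _)

  above-pos : ∀ {v i} → height at v <ᵣ height at i → Positive (above v at i)
  above-pos {v} {i} lt = subst Positive (sym (at-above v i)) (<⇒0<- lt)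

  above-pos⁻ : ∀ {v i} → Positive (above v at i) → height at v <ᵣ height at i
  above-pos⁻ {v} {i} 0<i = 0<-⇒< (subst Positive (at-above v i) 0<i)

  above-injective : ∀ v {i j} → above v at i ≡ above v at j → i ≡ j
  above-injective v {i} {j} eq = height-injective (+-cancelˡ _ _ _
    (trans (+-comm _ _) (trans (sym (at-above v i)) (trans eq (trans (at-above v j) (+-comm _ _))))))

  Collinear : FinSet n → Set
  Collinear Q = ∃[ φ ] Nondegenerate φ × (∀ i → i ∈ Q → φ at i ≡ 0ᵣ)

  line : Fin n → Fin n → Form
  line i j = form (y j - y i) (x i - x j) (x j · y i - x i · y j)

  line-source : ∀ i j → line i j at i ≡ 0ᵣ
  line-source i j = trans (solve 4 (λ xi yi xj yj →
    (yj :- yi) :* xi :+ (xi :- xj) :* yi :+ (xj :* yi :- xi :* yj) := yi :- yi) refl (x i) (y i) (x j) (y j))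
    (-‿inverseʳ (y i))

  line-target : ∀ i j → line i j at j ≡ 0ᵣ
  line-target i j = trans (solve 4 (λ xi yi xj yj →
    (yj :- yi) :* xj :+ (xi :- xj) :* yj :+ (xj :* yi :- xi :* yj) := yi :- yi) refl (x i) (y i) (x j) (y j))
    (-‿inverseʳ (y i))

  line-nondegenerate : ∀ {i j} → i ≢ j → Nondegenerate (line i j)
  line-nondegenerate i≢j (Δy≡0 , Δx≡0) = i≢j (xy-injective (-≡0⇒≡ Δx≡0) (sym (-≡0⇒≡ Δy≡0)))

  nondegenerate-cancel : ∀ φ {z} → Nondegenerate φ → a φ · z ≡ 0ᵣ → b φ · z ≡ 0ᵣ → z ≡ 0ᵣ
  nondegenerate-cancel φ {z} nd az≡0 bz≡0 with a φ ≟ 0ᵣ | b φ ≟ 0ᵣ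
  ... | no a≢0  | _       = ·≡0 a≢0 az≡0
  ... | yes _   | no b≢0  = ·≡0 b≢0 bz≡0
  ... | yes a≡0 | yes b≡0 = contradiction (a≡0 , b≡0) nd

  at-difference : ∀ φ i j → φ at j - φ at i ≡ a φ · (x j - x i) + b φ · (y j - y i)
  at-difference (form a b c) i j = solve 7 (λ a b c xi yi xj yj →
    (a :* xj :+ b :* yj :+ c) :- (a :* xi :+ b :* yi :+ c) := a :* (xj :- xi) :+ b :* (yj :- yi))
    refl a b c (x i) (y i) (x j) (y j)

  direction : ∀ φ {i j} → φ at i ≡ 0ᵣ → φ at j ≡ 0ᵣ → a φ · (x j - x i) + b φ · (y j - y i) ≡ 0ᵣ
  direction φ {i} {j} φi≡0 φj≡0 = trans (sym (at-difference φ i j)) (x≈y⇒x∙y⁻¹≈ε (trans φj≡0 (sym φi≡0)))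

  0+0 : ∀ {u v α β} → u ≡ 0ᵣ → v ≡ 0ᵣ → α · u + β · v ≡ 0ᵣ
  0+0 {α = α} {β} refl refl = trans (cong₂ _+_ (zeroʳ α) (zeroʳ β)) (+-identityʳ 0ᵣ)

  -- Both linear parts kill the nonzero vector from i to j, so `determinant` vanishes. Then each
  -- coefficient of φ annihilates the value of the linear part of ψ on the vector from i to k, and
  -- one of these coefficients is nonzero.
  line-unique : ∀ φ ψ {i j k} → Nondegenerate φ → i ≢ j → φ at i ≡ 0ᵣ → φ at j ≡ 0ᵣ →
    ψ at i ≡ 0ᵣ → ψ at j ≡ 0ᵣ → φ at k ≡ 0ᵣ → ψ at k ≡ 0ᵣ
  line-unique φ ψ {i} {j} {k} nd i≢j φi φj ψi ψj φk = begin
    ψ at k                              ≡⟨ solve 2 (λ u v → u := v :+ (u :- v)) refl (ψ at k) (ψ at i) ⟩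
    ψ at i + (ψ at k - ψ at i)          ≡⟨ cong₂ _+_ ψi (at-difference ψ i k) ⟩
    0ᵣ + (a ψ · X + b ψ · Y)            ≡⟨ +-identityˡ _ ⟩
    a ψ · X + b ψ · Y                   ≡⟨ nondegenerate-cancel φ nd a-part b-part ⟩
    0ᵣ                                  ∎
    where
    open ≡-Reasoning
    X = x k - x i
    Y = y k - y i
    dx = x j - x i
    dy = y j - y i
    φd = direction φ φi φj
    ψd = direction ψ ψi ψj
    φX = direction φ φi φk
    determinant = a φ · b ψ - a ψ · b φ
    determinant≡0 : determinant ≡ 0ᵣ
    determinant≡0 with dx ≟ 0ᵣ | dy ≟ 0ᵣ
    ... | no dx≢0 | _ = ·≡0 dx≢0 (trans
      (solve 6 (λ a b a′ b′ u v → u :* (a :* b′ :- a′ :* b) := b′ :* (a :* u :+ b :* v) :+ :- b :* (a′ :* u :+ b′ :* v))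
        refl (a φ) (b φ) (a ψ) (b ψ) dx dy) (0+0 φd ψd))
    ... | yes _ | no dy≢0 = ·≡0 dy≢0 (trans
      (solve 6 (λ a b a′ b′ u v → v :* (a :* b′ :- a′ :* b) := :- a′ :* (a :* u :+ b :* v) :+ a :* (a′ :* u :+ b′ :* v))
        refl (a φ) (b φ) (a ψ) (b ψ) dx dy) (0+0 φd ψd))
    ... | yes dx≡0 | yes dy≡0 = contradiction (xy-injective (sym (-≡0⇒≡ dx≡0)) (sym (-≡0⇒≡ dy≡0))) i≢j
    a-part : a φ · (a ψ · X + b ψ · Y) ≡ 0ᵣ
    a-part = trans
      (solve 6 (λ a b a′ b′ u v → a :* (a′ :* u :+ b′ :* v) := a′ :* (a :* u :+ b :* v) :+ v :* (a :* b′ :- a′ :* b))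
        refl (a φ) (b φ) (a ψ) (b ψ) X Y) (0+0 φX determinant≡0)
    b-part : b φ · (a ψ · X + b ψ · Y) ≡ 0ᵣ
    b-part = trans
      (solve 6 (λ a b a′ b′ u v → b :* (a′ :* u :+ b′ :* v) := b′ :* (a :* u :+ b :* v) :+ :- u :* (a :* b′ :- a′ :* b))
        refl (a φ) (b φ) (a ψ) (b ψ) X Y) (0+0 φX determinant≡0)

  vertical : Fin n → Form
  vertical i = form 1ᵣ 0ᵣ (-ᵣ x i)

  vertical-at : ∀ i → vertical i at i ≡ 0ᵣ
  vertical-at i = trans (cong (_- x i) (trans (cong₂ _+_ (*-identityˡ (x i)) (zeroˡ (y i))) (+-identityʳ (x i)))) (-‿inverseʳ (x i))

  vertical-nondegenerate : ∀ i → Nondegenerate (vertical i)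
  vertical-nondegenerate i (1≡0 , _) = 0≢1 (sym 1≡0)

  abstract
    -- Two distinct points of Q leave one candidate line, and `line-unique` turns a point off it
    -- into a refutation; a set with fewer points lies on a vertical line.
    collinear? : ∀ Q → Dec (Collinear Q)
    collinear? Q with 0 ℕ.<? count Q
    ... | no empty = yes (form 1ᵣ 0ᵣ 0ᵣ , (λ (1≡0 , _) → 0≢1 (sym 1≡0)) , λ i i∈Q → contradiction (∈⇒0<count i∈Q) empty)
    ... | yes nonempty with 0<count⇒∈ Q nonempty
    ...   | i , i∈Q with forall? Q (λ j → i Fin.≟ j)
    ...     | inj₁ all≡i = yes (vertical i , vertical-nondegenerate i ,
                λ j j∈Q → subst (λ j → vertical i at j ≡ 0ᵣ) (all≡i j j∈Q) (vertical-at i))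
    ...     | inj₂ (j , j∈Q , i≢j) with forall? Q (λ k → line i j at k ≟ 0ᵣ)
    ...       | inj₁ on-line = yes (line i j , line-nondegenerate i≢j , on-line)
    ...       | inj₂ (k , k∈Q , off-line) = no λ (φ , nd , on-φ) → off-line
                  (line-unique φ (line i j) nd i≢j (on-φ i i∈Q) (on-φ j j∈Q) (line-source i j) (line-target i j) (on-φ k k∈Q))

  off-line-point : ∀ {Q} φ → ¬ Collinear Q → Nondegenerate φ → ∃[ i ] i ∈ Q × φ at i ≢ 0ᵣ
  off-line-point {Q} φ ¬col nd with forall? Q (λ i → φ at i ≟ 0ᵣ)
  ... | inj₁ on-line = contradiction (φ , nd , on-line) ¬col
  ... | inj₂ off     = off

  -- The parameter t comes from the heights. The error vector `(ex , ey)` between j and the point at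
  -- t is killed by the linear parts of φ and of `height`. These are independent because `height` is
  -- not constant on the line, so the error is zero.
  between-on-line : ∀ φ {i j k} → Nondegenerate φ → φ at i ≡ 0ᵣ → φ at j ≡ 0ᵣ → φ at k ≡ 0ᵣ →
    height at i <ᵣ height at j → height at j <ᵣ height at k → Between i k j
  between-on-line φ {i} {j} {k} nd φi φj φk hi<hj hj<hk =
    t , ·-pos (<⇒0<- hi<hj) (inv-pos 0<Δ) , t<1 , x-eq , y-eq
    where
    open ≡-Reasoning
    Δ = height at k - height at i
    0<Δ : Positive Δ
    0<Δ = <⇒0<- (<-trans hi<hj hj<hk)
    Δ≢0 : Δ ≢ 0ᵣ
    Δ≢0 = <⇒≢ 0<Δ ∘ sym
    t = (height at j - height at i) · inv Δ
    t·Δ : t · Δ ≡ height at j - height at i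
    t·Δ = trans (solve 3 (λ u i d → u :* i :* d := u :* (d :* i)) refl (height at j - height at i) (inv Δ) Δ)
      (trans (cong ((height at j - height at i) ·_) (·-inv Δ≢0)) (*-identityʳ _))
    t<1 : t <ᵣ 1ᵣ
    t<1 = 0<-⇒< (subst Positive (begin
      (height at k - height at j) · inv Δ
        ≡⟨ solve 4 (λ i j k e → (k :- j) :* e := (k :- i) :* e :- (j :- i) :* e) refl (height at i) (height at j) (height at k) (inv Δ) ⟩
      Δ · inv Δ - t ≡⟨ cong (_- t) (·-inv Δ≢0) ⟩
      1ᵣ - t        ∎) (·-pos (<⇒0<- hj<hk) (inv-pos 0<Δ)))
    dx = x k - x i
    dy = y k - y i
    ex = (x j - x i) - t · dx
    ey = (y j - y i) - t · dy
    φe : a φ · ex + b φ · ey ≡ 0ᵣ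
    φe = begin
      a φ · ex + b φ · ey
        ≡⟨ solve 7 (λ a b t u v d e → a :* (u :- t :* d) :+ b :* (v :- t :* e) := (a :* u :+ b :* v) :- t :* (a :* d :+ b :* e))
             refl (a φ) (b φ) t (x j - x i) (y j - y i) dx dy ⟩
      (a φ · (x j - x i) + b φ · (y j - y i)) - t · (a φ · dx + b φ · dy)
        ≡⟨ cong₂ (λ u v → u - t · v) (direction φ φi φj) (direction φ φi φk) ⟩
      0ᵣ - t · 0ᵣ   ≡⟨ trans (cong (λ z → 0ᵣ - z) (zeroʳ t)) (-‿inverseʳ 0ᵣ) ⟩
      0ᵣ            ∎
    he : tilt · ex + ey ≡ 0ᵣ
    he = begin
      tilt · ex + ey            ≡⟨ cong (tilt · ex +_) (sym (*-identityˡ ey)) ⟩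
      tilt · ex + 1ᵣ · ey
        ≡⟨ solve 7 (λ a b t u v d e → a :* (u :- t :* d) :+ b :* (v :- t :* e) := (a :* u :+ b :* v) :- t :* (a :* d :+ b :* e))
             refl tilt 1ᵣ t (x j - x i) (y j - y i) dx dy ⟩
      (tilt · (x j - x i) + 1ᵣ · (y j - y i)) - t · (tilt · dx + 1ᵣ · dy)
        ≡⟨ cong₂ (λ u v → u - t · v) (sym (at-difference height i j)) (sym (at-difference height i k)) ⟩
      (height at j - height at i) - t · Δ ≡⟨ x≈y⇒x∙y⁻¹≈ε (sym t·Δ) ⟩
      0ᵣ                        ∎
    -- The determinant of the two linear parts: were it zero, `Δ · b φ` would vanish, and with it
    -- both coefficients of φ.
    slope≢0 : a φ - b φ · tilt ≢ 0ᵣ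
    slope≢0 slope≡0 = nd (a≡0 , b≡0)
      where
      b≡0 : b φ ≡ 0ᵣ
      b≡0 = ·≡0 Δ≢0 (begin
        Δ · b φ                         ≡⟨ cong (_· b φ) (at-difference height i k) ⟩
        (tilt · dx + 1ᵣ · dy) · b φ     ≡⟨ cong (λ z → (tilt · dx + z) · b φ) (*-identityˡ dy) ⟩
        (tilt · dx + dy) · b φ
          ≡⟨ solve 5 (λ m d e a b → (m :* d :+ e) :* b := (a :* d :+ b :* e) :- d :* (a :- b :* m)) refl tilt dx dy (a φ) (b φ) ⟩
        (a φ · dx + b φ · dy) - dx · (a φ - b φ · tilt) ≡⟨ cong₂ (λ u v → u - dx · v) (direction φ φi φk) slope≡0 ⟩
        0ᵣ - dx · 0ᵣ ≡⟨ trans (cong (λ z → 0ᵣ - z) (zeroʳ dx)) (-‿inverseʳ 0ᵣ) ⟩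
        0ᵣ           ∎)
      a≡0 : a φ ≡ 0ᵣ
      a≡0 = trans (-≡0⇒≡ slope≡0) (trans (cong (_· tilt) b≡0) (zeroˡ tilt))
    ex≡0 : ex ≡ 0ᵣ
    ex≡0 = ·≡0 slope≢0 (begin
      (a φ - b φ · tilt) · ex
        ≡⟨ solve 5 (λ a b m u v → (a :- b :* m) :* u := (a :* u :+ b :* v) :- b :* (m :* u :+ v)) refl (a φ) (b φ) tilt ex ey ⟩
      (a φ · ex + b φ · ey) - b φ · (tilt · ex + ey) ≡⟨ cong₂ (λ u v → u - b φ · v) φe he ⟩
      0ᵣ - b φ · 0ᵣ ≡⟨ trans (cong (λ z → 0ᵣ - z) (zeroʳ (b φ))) (-‿inverseʳ 0ᵣ) ⟩
      0ᵣ            ∎)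
    ey≡0 : ey ≡ 0ᵣ
    ey≡0 = begin
      ey             ≡⟨ sym (+-identityˡ ey) ⟩
      0ᵣ + ey        ≡⟨ cong (_+ ey) (sym (trans (cong (tilt ·_) ex≡0) (zeroʳ tilt))) ⟩
      tilt · ex + ey ≡⟨ he ⟩
      0ᵣ             ∎
    x-eq : x j ≡ x i + t · dx
    x-eq = trans (solve 2 (λ u v → u := v :+ (u :- v)) refl (x j) (x i)) (cong (x i +_) (-≡0⇒≡ ex≡0))
    y-eq : y j ≡ y i + t · dy
    y-eq = trans (solve 2 (λ u v → u := v :+ (u :- v)) refl (y j) (y i)) (cong (y i +_) (-≡0⇒≡ ey≡0))

-- Lower bounds for blockers on the two sides of a line

module Blocking (R : RealField) {n : ℕ} (p : Fin n → Plane.Point R) (p-inj : Injective _≡_ _≡_ p)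
                (col : Fin n → Bool) where
  open Geometry R p p-inj public

  coloured : Bool → FinSet n
  coloured c i = ⌊ col i Bool.≟ c ⌋

  coloured⁺ : ∀ {c i} → col i ≡ c → i ∈ coloured c
  coloured⁺ eq = mem (fromWitness eq)

  coloured⁻ : ∀ {c i} → i ∈ coloured c → col i ≡ c
  coloured⁻ (mem e) = toWitness e

  #_on_ : Bool → FinSet n → ℕ
  # c on Q = count (Q ∩ coloured c)

  #-pos⇒∈ : ∀ {Q} c → 1 ℕ.≤ # c on Q → ∃[ i ] i ∈ Q × col i ≡ c
  #-pos⇒∈ {Q} c 1≤# with 0<count⇒∈ (Q ∩ coloured c) 1≤#
  ... | i , i∈ = i , proj₁ (∩⁻ i∈) , coloured⁻ (proj₂ (∩⁻ {P = Q} i∈))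

  Blocks : FinSet n → FinSet n → Set
  Blocks Q C = ∀ {i j} → i ∈ Q → j ∈ Q → col i ≢ col j → ∃[ k ] k ∈ C × Between i j k

  -- Quantified over all `C`, so that an induction can apply it to the share of a blocking set that
  -- falls into one half-plane.
  NeedsBlockers : FinSet n → ℕ → Set
  NeedsBlockers Q k = ∀ C → Blocks Q C → k ℕ.≤ count C

  needs-0 : ∀ {Q} → NeedsBlockers Q 0
  needs-0 C _ = z≤n

  needs-⊆ : ∀ {Q Q′ k} → Q ⊆ Q′ → NeedsBlockers Q k → NeedsBlockers Q′ k
  needs-⊆ Q⊆Q′ needs C blocks = needs C λ i∈Q j∈Q → blocks (Q⊆Q′ _ i∈Q) (Q⊆Q′ _ j∈Q)

  positive : Form → FinSet n
  positive φ i = ⌊ 0ᵣ <? (φ at i) ⌋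

  positive⁺ : ∀ {φ i} → Positive (φ at i) → i ∈ positive φ
  positive⁺ 0<φi = mem (fromWitness 0<φi)

  positive⁻ : ∀ {φ i} → i ∈ positive φ → Positive (φ at i)
  positive⁻ (mem e) = toWitness e

  kernel : Form → FinSet n
  kernel φ i = ⌊ (φ at i) ≟ 0ᵣ ⌋

  kernel⁺ : ∀ {φ i} → φ at i ≡ 0ᵣ → i ∈ kernel φ
  kernel⁺ φi≡0 = mem (fromWitness φi≡0)

  kernel⁻ : ∀ {φ i} → i ∈ kernel φ → φ at i ≡ 0ᵣ
  kernel⁻ (mem e) = toWitness e

  needs-1 : ∀ {Q} → (∀ c → 1 ℕ.≤ # c on Q) → NeedsBlockers Q 1
  needs-1 {Q} both C blocks with #-pos⇒∈ {Q} true (both true) | #-pos⇒∈ {Q} false (both false)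
  ... | i , i∈Q , ci | j , j∈Q , cj with blocks i∈Q j∈Q (λ eq → contradiction (trans (sym ci) (trans eq cj)) λ ())
  ...   | k , k∈C , _ = ∈⇒0<count k∈C

  module _ {Q Q⁻ Q⁺ : FinSet n} (φ : Form) (Q⁻⊆Q : Q⁻ ⊆ Q) (Q⁺⊆Q : Q⁺ ⊆ Q)
           (φ≤0 : ∀ {i} → i ∈ Q⁻ → φ at i ≤ᵣ 0ᵣ) (0<φ : ∀ {i} → i ∈ Q⁺ → Positive (φ at i)) where

    -- The closed side φ ≤ 0 and the open side φ > 0 are both convex, so a blocker of a pair lies on
    -- the side of that pair.
    needs-cut : ∀ {k⁻ k⁺} → NeedsBlockers Q⁻ k⁻ → NeedsBlockers Q⁺ k⁺ → NeedsBlockers Q (k⁻ ℕ.+ k⁺)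
    needs-cut {k⁻} {k⁺} needs⁻ needs⁺ C blocks = begin
      k⁻ ℕ.+ k⁺                                               ≡⟨ ℕ.+-comm k⁻ k⁺ ⟩
      k⁺ ℕ.+ k⁻                                               ≤⟨ ℕ.+-mono-≤ (needs⁺ _ blocks⁺) (needs⁻ _ blocks⁻) ⟩
      count (C ∩ positive φ) ℕ.+ count (C ∩ ∁ (positive φ))   ≡⟨ sym (count-split C (positive φ)) ⟩
      count C                                                 ∎
      where
      open ℕ.≤-Reasoning
      blocks⁺ : Blocks Q⁺ (C ∩ positive φ)
      blocks⁺ i∈ j∈ ci≢cj with blocks (Q⁺⊆Q _ i∈) (Q⁺⊆Q _ j∈) ci≢cj
      ... | k , k∈C , k∈ij = k , ∩⁺ k∈C (positive⁺ {φ} (between-pos φ k∈ij (0<φ i∈) (0<φ j∈))) , k∈ij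
      blocks⁻ : Blocks Q⁻ (C ∩ ∁ (positive φ))
      blocks⁻ i∈ j∈ ci≢cj with blocks (Q⁻⊆Q _ i∈) (Q⁻⊆Q _ j∈) ci≢cj
      ... | k , k∈C , k∈ij = k , ∩⁺ k∈C (∁⁺ (between-nonpos φ k∈ij (φ≤0 i∈) (φ≤0 j∈) ∘ positive⁻ {φ})) , k∈ij

  -- The blockers inside Q₁, those on the line ℓ of K, and those on the segments
  -- from t to the points of K of the other colour are pairwise disjoint.
  module _ {Q Q₁ K : FinSet n} (Q₁⊆Q : Q₁ ⊆ Q) (K⊆Q : K ⊆ Q)
           (ℓ : Form) (ℓ≡0 : ∀ {i} → i ∈ K → ℓ at i ≡ 0ᵣ) where

    needs-fan : ∀ {t k₁ k₂} ψ → t ∈ Q₁ → ψ at t ≡ 0ᵣ → ℓ at t ≢ 0ᵣ →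
      (∀ {i} → i ∈ Q₁ → ψ at i ≤ᵣ 0ᵣ) → (∀ {i} → i ∈ K → Positive (ψ at i)) →
      NeedsBlockers Q₁ k₁ → 1 ℕ.≤ k₂ → (∀ c → k₂ ℕ.≤ # c on K) → NeedsBlockers Q (k₁ ℕ.+ suc k₂)
    needs-fan {t} {k₁} {k₂} ψ t∈Q₁ ψt≡0 ℓt≢0 ψ≤0 0<ψ needs₁ 1≤k₂ k₂≤# C blocks =
      needs-beyond (needs-cut-at needs₁)
      where
      -- Blockers for Q₁ lie on the closed side of ψ; the blocker on ℓ and those of the fan share
      -- the open side and are told apart by ℓ.
      beyond : FinSet n
      beyond = C ∩ positive ψ

      needs-cut-at : NeedsBlockers Q₁ k₁ → k₁ ℕ.≤ count (C ∩ ∁ (positive ψ))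
      needs-cut-at needs = needs _ λ i∈ j∈ ci≢cj → let k , k∈C , k∈ij = blocks (Q₁⊆Q _ i∈) (Q₁⊆Q _ j∈) ci≢cj in
        k , ∩⁺ k∈C (∁⁺ (between-nonpos ψ k∈ij (ψ≤0 i∈) (ψ≤0 j∈) ∘ positive⁻ {ψ})) , k∈ij

      on-ℓ : 1 ℕ.≤ count (beyond ∩ kernel ℓ)
      on-ℓ = needs-1 {K} (λ c → ℕ.≤-trans 1≤k₂ (k₂≤# c)) _ λ i∈ j∈ ci≢cj →
        let k , k∈C , k∈ij = blocks (K⊆Q _ i∈) (K⊆Q _ j∈) ci≢cj in
        k , ∩⁺ (∩⁺ k∈C (positive⁺ {ψ} (between-pos ψ k∈ij (0<ψ i∈) (0<ψ j∈))))
               (kernel⁺ {ℓ} (between-0 ℓ k∈ij (ℓ≡0 i∈) (ℓ≡0 j∈))) , k∈ij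

      opposite : FinSet n
      opposite = K ∩ coloured (not (col t))

      opposite⁻ : ∀ {j} → j ∈ opposite → j ∈ K × col t ≢ col j
      opposite⁻ j∈ = proj₁ (∩⁻ j∈) , λ eq → Bool.not-¬ {col t} refl (trans eq (coloured⁻ (proj₂ (∩⁻ {P = K} j∈))))

      fan : count opposite ℕ.≤ count (beyond ∩ ∁ (kernel ℓ))
      fan = pigeonhole opposite _ (Between t)
        (λ j j∈ → let j∈K , ct≢cj = opposite⁻ j∈ ; k , k∈C , k∈tj = blocks (Q₁⊆Q _ t∈Q₁) (K⊆Q _ j∈K) ct≢cj in
          k , ∩⁺ (∩⁺ k∈C (positive⁺ {ψ} (between-0-pos ψ k∈tj ψt≡0 (0<ψ j∈K))))
                 (∁⁺ (between-≢0 ℓ k∈tj ℓt≢0 (ℓ≡0 j∈K) ∘ kernel⁻ {ℓ})) , k∈tj)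
        (λ i∈ j∈ → between-fan ℓ ℓt≢0 (ℓ≡0 (proj₁ (opposite⁻ i∈))) (ℓ≡0 (proj₁ (opposite⁻ j∈))))

      needs-beyond : k₁ ℕ.≤ count (C ∩ ∁ (positive ψ)) → k₁ ℕ.+ suc k₂ ℕ.≤ count C
      needs-beyond k₁≤ = begin
        k₁ ℕ.+ suc k₂                                         ≤⟨ ℕ.+-mono-≤ k₁≤ (ℕ.+-mono-≤ on-ℓ (ℕ.≤-trans (k₂≤# _) fan)) ⟩
        count (C ∩ ∁ (positive ψ)) ℕ.+ (count (beyond ∩ kernel ℓ) ℕ.+ count (beyond ∩ ∁ (kernel ℓ)))
          ≡⟨ cong (count (C ∩ ∁ (positive ψ)) ℕ.+_) (sym (count-split beyond (kernel ℓ))) ⟩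
        count (C ∩ ∁ (positive ψ)) ℕ.+ count beyond           ≡⟨ ℕ.+-comm (count (C ∩ ∁ (positive ψ))) _ ⟩
        count beyond ℕ.+ count (C ∩ ∁ (positive ψ))           ≡⟨ sym (count-split C (positive ψ)) ⟩
        count C                                               ∎
        where open ℕ.≤-Reasoning

    -- The lines ℓ(t) φ = φ(t) ℓ all pass through {ℓ = φ = 0}; the one that first meets a
    -- point t of Q₁ off ℓ still separates K from Q₁.
    needs-separated : ∀ {s k₁ k₂} φ → (∀ {i} → i ∈ Q₁ → φ at i ≤ᵣ 0ᵣ) → (∀ {i} → i ∈ K → Positive (φ at i)) →
      s ∈ Q₁ → Positive (ℓ at s) →
      NeedsBlockers Q₁ k₁ → 1 ℕ.≤ k₂ → (∀ c → k₂ ℕ.≤ # c on K) → NeedsBlockers Q (k₁ ℕ.+ suc k₂)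
    needs-separated {s} φ φ≤0 0<φ s∈Q₁ 0<ℓs
      -- Because of the minus sign, t maximises φ / ℓ among the points of Q₁ on the positive side of
      -- ℓ, where this ratio is nonpositive.
      with argmin (Q₁ ∩ positive ℓ) (λ i → -ᵣ (φ at i · inv (ℓ at i))) (s , ∩⁺ s∈Q₁ (positive⁺ {ℓ} 0<ℓs))
    ... | t , t∈ , minimal = needs-fan ψ t∈Q₁ ψt≡0 (<⇒≢ 0<ℓt ∘ sym) ψ≤0 0<ψ
      where
      t∈Q₁ = proj₁ (∩⁻ t∈)
      0<ℓt : Positive (ℓ at t)
      0<ℓt = positive⁻ {ℓ} (proj₂ (∩⁻ {P = Q₁} t∈))
      ψ = combine (ℓ at t) φ (-ᵣ (φ at t)) ℓ 0ᵣ
      at-ψ : ∀ i → ψ at i ≡ ℓ at t · φ at i - φ at t · ℓ at i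
      at-ψ i = trans (at-combine _ φ _ ℓ _ i) (trans (+-identityʳ _)
        (solve 4 (λ a b c d → a :* b :+ :- c :* d := a :* b :- c :* d) refl (ℓ at t) (φ at i) (φ at t) (ℓ at i)))
      ψt≡0 : ψ at t ≡ 0ᵣ
      ψt≡0 = trans (at-ψ t) (x≈y⇒x∙y⁻¹≈ε (*-comm (ℓ at t) (φ at t)))
      0<ψ : ∀ {i} → i ∈ K → Positive (ψ at i)
      0<ψ {i} i∈K = subst Positive
        (sym (trans (at-ψ i) (trans (cong (λ z → ℓ at t · φ at i - z) (trans (cong (φ at t ·_) (ℓ≡0 i∈K)) (zeroʳ _))) (x-0≡x _))))
        (·-pos 0<ℓt (0<φ i∈K))
      ψ≤0 : ∀ {i} → i ∈ Q₁ → ψ at i ≤ᵣ 0ᵣ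
      ψ≤0 {i} i∈Q₁ 0<ψi with 0ᵣ <? ℓ at i
      ... | yes 0<ℓi = minimal i (∩⁺ i∈Q₁ (positive⁺ {ℓ} 0<ℓi))
          (0<-⇒< (pos-cancelˡ (·-pos 0<ℓt 0<ℓi) (subst Positive (sym (begin
            (ℓ at t · ℓ at i) · (-ᵣ (φ at t · inv (ℓ at t)) - (-ᵣ (φ at i · inv (ℓ at i))))
              ≡⟨ solve 6 (λ lt li f g u v → (lt :* li) :* ((:- (f :* u)) :- (:- (g :* v))) :=
                   lt :* g :* (li :* v) :- f :* li :* (lt :* u))
                   refl (ℓ at t) (ℓ at i) (φ at t) (φ at i) (inv (ℓ at t)) (inv (ℓ at i)) ⟩
            ℓ at t · φ at i · (ℓ at i · inv (ℓ at i)) - φ at t · ℓ at i · (ℓ at t · inv (ℓ at t))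
              ≡⟨ cong₂ (λ u v → ℓ at t · φ at i · u - φ at t · ℓ at i · v) (·-inv (<⇒≢ 0<ℓi ∘ sym)) (·-inv (<⇒≢ 0<ℓt ∘ sym)) ⟩
            ℓ at t · φ at i · 1ᵣ - φ at t · ℓ at i · 1ᵣ
              ≡⟨ cong₂ _-_ (*-identityʳ _) (*-identityʳ _) ⟩
            ℓ at t · φ at i - φ at t · ℓ at i ≡⟨ sym (at-ψ i) ⟩
            ψ at i ∎)) 0<ψi)))
        where open ≡-Reasoning
      -- Both `φ at t` and `ℓ at i` are nonpositive, hence their product is nonnegative and both
      -- terms of ψ are nonpositive.
      ... | no ℓi≤0 = +-nonpos (·-nonpos 0<ℓt (φ≤0 i∈Q₁)) tail≤0 (subst Positive (at-ψ i) 0<ψi)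
        where
        tail≤0 : -ᵣ (φ at t · ℓ at i) ≤ᵣ 0ᵣ
        tail≤0 with compare (φ at t) 0ᵣ
        ... | tri> _ _ 0<φt = contradiction 0<φt (φ≤0 t∈Q₁)
        ... | tri< φt<0 _ _ = subst (_≤ᵣ 0ᵣ) (solve 2 (λ f l → :- f :* l := :- (f :* l)) refl (φ at t) (ℓ at i))
                (·-nonpos (neg⇒0<- φt<0) ℓi≤0)
        ... | tri≈ _ φt≡0 _ = subst (_≤ᵣ 0ᵣ) (sym (trans (cong (λ z → -ᵣ (z · ℓ at i)) φt≡0)
                (trans (cong -ᵣ_ (zeroˡ _)) -0#≈0#))) irrefl

  scale : Carrier → Form → Form
  scale u φ = combine u φ 0ᵣ φ 0ᵣ

  at-scale : ∀ u φ i → scale u φ at i ≡ u · φ at i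
  at-scale u φ i = trans (at-combine u φ 0ᵣ φ 0ᵣ i) (trans (+-identityʳ _)
    (trans (cong (u · φ at i +_) (zeroˡ _)) (+-identityʳ _)))

  -- Multiplying ℓ by its value at s makes it positive at s and keeps its zeros on K, so s may lie
  -- on either side of ℓ.
  needs-off-line : ∀ {Q Q₁ K : FinSet n} → Q₁ ⊆ Q → K ⊆ Q → (ℓ : Form) → (∀ {i} → i ∈ K → ℓ at i ≡ 0ᵣ) →
    ∀ {s k₁ k₂} φ → (∀ {i} → i ∈ Q₁ → φ at i ≤ᵣ 0ᵣ) → (∀ {i} → i ∈ K → Positive (φ at i)) →
    s ∈ Q₁ → ℓ at s ≢ 0ᵣ →
    NeedsBlockers Q₁ k₁ → 1 ℕ.≤ k₂ → (∀ c → k₂ ℕ.≤ # c on K) → NeedsBlockers Q (k₁ ℕ.+ suc k₂)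
  needs-off-line Q₁⊆Q K⊆Q ℓ ℓ≡0 {s} φ φ≤0 0<φ s∈Q₁ ℓs≢0 =
    needs-separated Q₁⊆Q K⊆Q (scale (ℓ at s) ℓ)
      (λ {i} i∈K → trans (at-scale (ℓ at s) ℓ i) (trans (cong (ℓ at s ·_) (ℓ≡0 i∈K)) (zeroʳ _)))
      φ φ≤0 0<φ s∈Q₁ (subst Positive (sym (at-scale (ℓ at s) ℓ s)) (≢0⇒0<² ℓs≢0))

-- Balanced cuts of a two-coloured point set

module Cutting (R : RealField) {n : ℕ} (p : Fin n → Plane.Point R) (p-inj : Injective _≡_ _≡_ p)
               (col : Fin n → Bool) where
  open Blocking R p p-inj col public

  #-≐ : ∀ {P Q} c → P ⊆ Q → Q ⊆ P → # c on P ≡ # c on Q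
  #-≐ c P⊆Q Q⊆P = count-≐
    (λ i i∈ → let i∈P , i∈c = ∩⁻ i∈ in ∩⁺ (P⊆Q i i∈P) i∈c)
    (λ i i∈ → let i∈Q , i∈c = ∩⁻ i∈ in ∩⁺ (Q⊆P i i∈Q) i∈c)

  #-split : ∀ c P S → # c on P ≡ # c on (P ∩ S) ℕ.+ # c on (P ∩ ∁ S)
  #-split c P S = trans (count-split (P ∩ coloured c) S) (cong₂ ℕ._+_ (swap S) (swap (∁ S)))
    where
    swap : ∀ S → count ((P ∩ coloured c) ∩ S) ≡ count ((P ∩ S) ∩ coloured c)
    swap S = count-≐ {P = (P ∩ coloured c) ∩ S} {(P ∩ S) ∩ coloured c}
      (λ i i∈ → let i∈Pc , i∈S = ∩⁻ {P = P ∩ coloured c} i∈ ; i∈P , i∈c = ∩⁻ {P = P} i∈Pc in ∩⁺ {P = P ∩ S} (∩⁺ {P = P} i∈P i∈S) i∈c)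
      (λ i i∈ → let i∈PS , i∈c = ∩⁻ {P = P ∩ S} i∈ ; i∈P , i∈S = ∩⁻ {P = P} i∈PS in ∩⁺ {P = P ∩ coloured c} (∩⁺ {P = P} i∈P i∈c) i∈S)

  #-∖-same : ∀ {Q i} → i ∈ Q → # (col i) on Q ≡ suc (# (col i) on (Q ∖ i))
  #-∖-same {Q} {i} i∈Q = trans (count-∖ (∩⁺ {P = Q} i∈Q (coloured⁺ refl))) (cong suc (count-≐
    {P = (Q ∩ coloured (col i)) ∖ i} {(Q ∖ i) ∩ coloured (col i)}
    (λ j j∈ → let j∈Qc , j≢i = ∖⁻ {P = Q ∩ coloured (col i)} j∈ ; j∈Q , j∈c = ∩⁻ {P = Q} j∈Qc in ∩⁺ {P = Q ∖ i} (∖⁺ {P = Q} j∈Q j≢i) j∈c)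
    (λ j j∈ → let j∈Q∖i , j∈c = ∩⁻ {P = Q ∖ i} j∈ ; j∈Q , j≢i = ∖⁻ {P = Q} j∈Q∖i in ∖⁺ {P = Q ∩ coloured (col i)} (∩⁺ {P = Q} j∈Q j∈c) j≢i)))

  #-∖-other : ∀ {Q i c} → col i ≢ c → # c on Q ≡ # c on (Q ∖ i)
  #-∖-other {Q} {i} {c} ci≢c = count-≐ {P = Q ∩ coloured c} {(Q ∖ i) ∩ coloured c}
    (λ j j∈ → let j∈Q , j∈c = ∩⁻ {P = Q} j∈ in ∩⁺ {P = Q ∖ i} (∖⁺ {P = Q} j∈Q (λ { refl → ci≢c (coloured⁻ j∈c) })) j∈c)
    (λ j j∈ → let j∈Q∖i , j∈c = ∩⁻ {P = Q ∖ i} j∈ in ∩⁺ {P = Q} (proj₁ (∖⁻ {P = Q} j∈Q∖i)) j∈c)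

  #-∖-≤ : ∀ {Q} i c → # c on (Q ∖ i) ℕ.≤ # c on Q
  #-∖-≤ {Q} i c = count-⊆ {P = (Q ∖ i) ∩ coloured c} {Q ∩ coloured c}
    λ j j∈ → let j∈Q∖i , j∈c = ∩⁻ {P = Q ∖ i} j∈ in ∩⁺ {P = Q} (proj₁ (∖⁻ {P = Q} j∈Q∖i)) j∈c

  #-∖-suc : ∀ {Q i} c → i ∈ Q → # c on Q ℕ.≤ suc (# c on (Q ∖ i))
  #-∖-suc {Q} {i} c i∈Q with col i Bool.≟ c
  ... | yes refl = ℕ.≤-reflexive (#-∖-same i∈Q)
  ... | no ci≢c  = ℕ.m≤n⇒m≤1+n (ℕ.≤-reflexive (#-∖-other {Q} ci≢c))

  below : (Fin n → Carrier) → Carrier → FinSet n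
  below κ z i = ⌊ κ i <? z ⌋

  below⁺ : ∀ {κ z i} → κ i <ᵣ z → i ∈ below κ z
  below⁺ lt = mem (fromWitness lt)

  below⁻ : ∀ {κ z i} → i ∈ below κ z → κ i <ᵣ z
  below⁻ (mem e) = toWitness e

  -- Removing the points in increasing order of κ changes the colour balance by one
  -- at a time.
  final-segment : ∀ c (κ : Fin n → Carrier) → (∀ {i j} → κ i ≡ κ j → i ≡ j) → ∀ N S → count S ℕ.≤ N →
    suc (# c on S) ℕ.≤ # (not c) on S →
    ∃[ m ] m ∈ S × suc (# c on (S ∩ ∁ (below κ (κ m)))) ≡ # (not c) on (S ∩ ∁ (below κ (κ m)))
  final-segment c κ κ-inj zero S |S|≤0 c<c̄ with #-pos⇒∈ {S} (not c) (ℕ.≤-trans (s≤s z≤n) c<c̄)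
  ... | i , i∈S , _ = contradiction (ℕ.≤-trans (∈⇒0<count i∈S) |S|≤0) λ ()
  final-segment c κ κ-inj (suc N) S |S|≤N c<c̄ with #-pos⇒∈ {S} (not c) (ℕ.≤-trans (s≤s z≤n) c<c̄)
  ... | i , i∈S , _ with argmin S κ (i , i∈S)
  ...   | m , m∈S , minimal with suc (# c on S) ℕ.≟ # (not c) on S
  ...     | yes balanced = m , m∈S , trans (cong suc (#-≐ c ⊆S S⊆)) (trans balanced (#-≐ (not c) S⊆ ⊆S))
    where
    ⊆S : S ∩ ∁ (below κ (κ m)) ⊆ S
    ⊆S j = proj₁ ∘ ∩⁻
    S⊆ : S ⊆ S ∩ ∁ (below κ (κ m))
    S⊆ j j∈S = ∩⁺ j∈S (∁⁺ (minimal j j∈S ∘ below⁻ {κ}))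
  ...     | no unbalanced with final-segment c κ κ-inj N (S ∖ m)
              (ℕ.s≤s⁻¹ (subst (ℕ._≤ suc N) (count-∖ m∈S) |S|≤N))
              (ℕ.≤-trans (s≤s (#-∖-≤ {S} m c)) (ℕ.s≤s⁻¹ (ℕ.≤-trans (ℕ.≤∧≢⇒< c<c̄ unbalanced) (#-∖-suc {S} (not c) m∈S))))
  ...       | m′ , m′∈ , balanced = m′ , proj₁ (∖⁻ {P = S} m′∈) ,
              trans (cong suc (#-≐ c S⊆ ⊆S)) (trans balanced (#-≐ (not c) ⊆S S⊆))
    where
    m<m′ : κ m <ᵣ κ m′
    m<m′ = ≤∧≢⇒< (minimal m′ (proj₁ (∖⁻ {P = S} m′∈))) (λ eq → proj₂ (∖⁻ {P = S} m′∈) (sym (κ-inj eq)))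
    ⊆S : (S ∖ m) ∩ ∁ (below κ (κ m′)) ⊆ S ∩ ∁ (below κ (κ m′))
    ⊆S j j∈ = ∩⁺ (proj₁ (∖⁻ {P = S} (proj₁ (∩⁻ {P = S ∖ m} j∈)))) (proj₂ (∩⁻ {P = S ∖ m} j∈))
    S⊆ : S ∩ ∁ (below κ (κ m′)) ⊆ (S ∖ m) ∩ ∁ (below κ (κ m′))
    S⊆ j j∈ = ∩⁺ {P = S ∖ m} (∖⁺ {P = S} (proj₁ (∩⁻ j∈)) λ { refl → ∁⁻ (proj₂ (∩⁻ {P = S} j∈)) (below⁺ {κ} m<m′) })
      (proj₂ (∩⁻ {P = S} j∈))

  module _ (Q : FinSet n) (k : ℕ) (balanced : ∀ c → # c on Q ≡ k) where

    record BalancedCut : Set where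
      field
        φ       : Form
        k⁻ k⁺   : ℕ
        1≤k⁻    : 1 ℕ.≤ k⁻
        1≤k⁺    : 1 ℕ.≤ k⁺
        sum     : k⁻ ℕ.+ k⁺ ≡ k
        #⁻      : ∀ c → # c on (Q ∩ ∁ (positive φ)) ≡ k⁻
        #⁺      : ∀ c → # c on (Q ∩ positive φ) ≡ k⁺

    -- Since Q is balanced, one balanced side forces the other to be. The point w shows that the
    -- positive side is nonempty, and its colour serves to define `k⁺`.
    cut-of : ∀ φ k⁻ {w} → 1 ℕ.≤ k⁻ → w ∈ Q → Positive (φ at w) → (∀ c → # c on (Q ∩ ∁ (positive φ)) ≡ k⁻) → BalancedCut
    cut-of φ k⁻ {w} 1≤k⁻ w∈Q 0<φw #⁻ = record
      { φ = φ ; k⁻ = k⁻ ; k⁺ = # (col w) on Q⁺ ; 1≤k⁻ = 1≤k⁻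
      ; 1≤k⁺ = ∈⇒0<count {P = Q⁺ ∩ coloured (col w)} (∩⁺ {P = Q⁺} (∩⁺ w∈Q (positive⁺ {φ} 0<φw)) (coloured⁺ refl))
      ; sum = total (col w) ; #⁻ = #⁻
      ; #⁺ = λ c → ℕ.+-cancelˡ-≡ k⁻ _ _ (trans (total c) (sym (total (col w)))) }
      where
      Q⁺ = Q ∩ positive φ
      total : ∀ c → k⁻ ℕ.+ # c on Q⁺ ≡ k
      total c = trans (ℕ.+-comm k⁻ _) (trans (cong (# c on Q⁺ ℕ.+_) (sym (#⁻ c)))
        (trans (sym (#-split c Q (positive φ))) (balanced c)))

    module Pencil {v} (v∈Q : v ∈ Q) (X : Form) (Xv≡0 : X at v ≡ 0ᵣ) (0<X : ∀ {i} → i ∈ Q → i ≢ v → Positive (X at i))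
                  (X-injective : ∀ {i j} → X at i ≡ X at j → i ≡ j) where

      slope : Form → Fin n → Carrier
      slope Y i = Y at i · inv (X at i)

      slope-· : ∀ Y {i} → i ≢ v → slope Y i · X at i ≡ Y at i
      slope-· Y {i} i≢v = trans (solve 3 (λ y i x → y :* i :* x := y :* (x :* i)) refl (Y at i) (inv (X at i)) (X at i))
        (trans (cong (Y at i ·_) (·-inv (λ Xi≡0 → i≢v (X-injective (trans Xi≡0 (sym Xv≡0)))))) (*-identityʳ _))

      -- Projectively, v is at infinity and a point has coordinates (Y / X , 1 / X);
      -- κ orders the points lexicographically in these, and κ ≥ κ m cuts off a half-plane.
      pencil-cut : ∀ Y S {w} → Y at v ≡ 0ᵣ → S ⊆ Q ∖ v → (∀ {i j} → i ∈ Q ∖ v → ¬ i ∈ S → j ∈ S → slope Y i <ᵣ slope Y j) →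
        suc (# (col v) on S) ℕ.≤ # (not (col v)) on S → w ∈ Q ∖ v → ¬ w ∈ S → BalancedCut
      pencil-cut Y S {w} Yv≡0 S⊆Q∖v upper c<c̄ w∈ w∉S =
        from-segment (final-segment (col v) κ κ-inj (count S) S ℕ.≤-refl c<c̄)
        where
        refinement = refine (slope Y) (λ i → inv (X at i)) (λ _ eq → X-injective (inv-injective eq))
        M = proj₁ refinement
        κ : Fin n → Carrier
        κ i = M · slope Y i + inv (X at i)
        κ-inj : ∀ {i j} → κ i ≡ κ j → i ≡ j
        κ-inj = proj₁ (proj₂ refinement)
        mono : ∀ {i j} → slope Y i <ᵣ slope Y j → κ i <ᵣ κ j
        mono = proj₂ (proj₂ refinement)
        from-segment : ∃[ m ] m ∈ S × suc (# (col v) on (S ∩ ∁ (below κ (κ m)))) ≡ # (not (col v)) on (S ∩ ∁ (below κ (κ m))) →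
          BalancedCut
        from-segment (m , m∈S , seg-balanced) = cut-of Ψ (# (not (col v)) on V) (subst (1 ℕ.≤_) seg-balanced (s≤s z≤n)) (proj₁ (∖⁻ {P = Q} w∈))
          (0<Ψ (proj₁ (∖⁻ {P = Q} w∈)) (proj₂ (∖⁻ {P = Q} w∈)) (mono (upper w∈ w∉S m∈S))) #⁻
          where
          V = S ∩ ∁ (below κ (κ m))
          -- Off v this is X times `κ m - κ i`. The constant -1 stems from `X · inv X`, and at v,
          -- where X and Y vanish, it alone puts v on the closed side.
          Ψ = combine (κ m) X (-ᵣ M) Y (-ᵣ 1ᵣ)
          Q⁻ = Q ∩ ∁ (positive Ψ)
          Xi≢0 : ∀ {i} → i ≢ v → X at i ≢ 0ᵣ
          Xi≢0 i≢v Xi≡0 = i≢v (X-injective (trans Xi≡0 (sym Xv≡0)))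
          at-Ψ : ∀ {i} → i ≢ v → Ψ at i ≡ X at i · (κ m - κ i)
          at-Ψ {i} i≢v = begin
            Ψ at i ≡⟨ at-combine (κ m) X (-ᵣ M) Y (-ᵣ 1ᵣ) i ⟩
            κ m · X at i + (-ᵣ M) · Y at i + -ᵣ 1ᵣ
              ≡⟨ cong₂ (λ u v → κ m · X at i + (-ᵣ M) · u + -ᵣ v) (sym (slope-· Y i≢v)) (sym (·-inv (Xi≢0 i≢v))) ⟩
            κ m · X at i + (-ᵣ M) · (slope Y i · X at i) + -ᵣ (X at i · inv (X at i))
              ≡⟨ solve 5 (λ k x m s i → k :* x :+ (:- m) :* (s :* x) :+ :- (x :* i) := x :* (k :- (m :* s :+ i)))
                   refl (κ m) (X at i) M (slope Y i) (inv (X at i)) ⟩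
            X at i · (κ m - κ i) ∎
            where open ≡-Reasoning
          0<Ψ : ∀ {i} → i ∈ Q → i ≢ v → κ i <ᵣ κ m → Positive (Ψ at i)
          0<Ψ i∈Q i≢v lt = subst Positive (sym (at-Ψ i≢v)) (·-pos (0<X i∈Q i≢v) (<⇒0<- lt))
          Ψ-pos⇒< : ∀ {i} → i ∈ Q → i ≢ v → Positive (Ψ at i) → κ i <ᵣ κ m
          Ψ-pos⇒< i∈Q i≢v 0<Ψi = 0<-⇒< (pos-cancelˡ (0<X i∈Q i≢v) (subst Positive (at-Ψ i≢v) 0<Ψi))
          Ψv≤0 : Ψ at v ≤ᵣ 0ᵣ
          Ψv≤0 = subst (_≤ᵣ 0ᵣ) (sym (begin
            Ψ at v ≡⟨ at-combine (κ m) X (-ᵣ M) Y (-ᵣ 1ᵣ) v ⟩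
            κ m · X at v + (-ᵣ M) · Y at v + -ᵣ 1ᵣ ≡⟨ cong (_+ -ᵣ 1ᵣ) (0+0 Xv≡0 Yv≡0) ⟩
            0ᵣ + -ᵣ 1ᵣ ≡⟨ +-identityˡ _ ⟩
            -ᵣ 1ᵣ ∎)) (<⇒≤ (pos⇒-<0 0<1))
            where open ≡-Reasoning
          v∈Q⁻ : v ∈ Q⁻
          v∈Q⁻ = ∩⁺ v∈Q (∁⁺ (Ψv≤0 ∘ positive⁻ {Ψ}))
          Q⁻⊆V : Q⁻ ∖ v ⊆ V
          Q⁻⊆V i i∈ with ∖⁻ {P = Q⁻} i∈
          ... | i∈Q⁻ , i≢v with ∩⁻ {P = Q} i∈Q⁻
          ...   | i∈Q , i∉pos with i ∈? S
          ...     | yes i∈S = ∩⁺ {P = S} i∈S (∁⁺ (λ lt → ∁⁻ i∉pos (positive⁺ {Ψ} (0<Ψ i∈Q i≢v (below⁻ {κ} lt)))))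
          ...     | no  i∉S = contradiction (positive⁺ {Ψ} (0<Ψ i∈Q i≢v (mono (upper (∖⁺ {P = Q} i∈Q i≢v) i∉S m∈S)))) (∁⁻ i∉pos)
          V⊆Q⁻ : V ⊆ Q⁻ ∖ v
          V⊆Q⁻ i i∈ with ∩⁻ {P = S} i∈
          ... | i∈S , i∉below with ∖⁻ {P = Q} (S⊆Q∖v i i∈S)
          ...   | i∈Q , i≢v = ∖⁺ {P = Q⁻} (∩⁺ {P = Q} i∈Q (∁⁺ λ 0<Ψi → ∁⁻ i∉below (below⁺ {κ} (Ψ-pos⇒< i∈Q i≢v (positive⁻ {Ψ} 0<Ψi))))) i≢v
          -- The segment lacks one point of the colour of v, and v, which lies on its side of the
          -- cut, supplies it.
          #⁻ : ∀ c → # c on Q⁻ ≡ # (not (col v)) on V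
          #⁻ c with col v Bool.≟ c
          ... | yes refl = trans (#-∖-same v∈Q⁻) (trans (cong suc (#-≐ (col v) Q⁻⊆V V⊆Q⁻)) seg-balanced)
          ... | no cv≢c = trans (#-∖-other {Q⁻} cv≢c) (trans (#-≐ c Q⁻⊆V V⊆Q⁻)
                  (cong (λ c → # c on V) (Bool.¬-not (cv≢c ∘ sym))))

    -- Without the lowest point v, the other colour is one ahead. This surplus shows in `G`, the
    -- points on the first ray from v, or in `H`, the rest. Sweeping only a part with a surplus
    -- keeps a point of the other part beyond the cut, which makes the cut proper; outside `G` there
    -- is such a point because Q is not collinear.
    balanced-cut : 1 ℕ.≤ k → ¬ Collinear Q → BalancedCut
    balanced-cut 1≤k ¬col with argmin Q (height at_) nonempty
      where
      nonempty : ∃[ i ] i ∈ Q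
      nonempty with #-pos⇒∈ {Q} true (subst (1 ℕ.≤_) (sym (balanced true)) 1≤k)
      ... | i , i∈Q , _ = i , i∈Q
    ... | v , v∈Q , lowest = by-group (argmin (Q ∖ v) s nonempty)
      where
      X = above v
      open Pencil v∈Q X (above-self v)
        (λ {i} i∈Q i≢v → above-pos (≤∧≢⇒< (lowest i i∈Q) (i≢v ∘ sym ∘ height-injective))) (above-injective v)
      Y = vertical v
      s = slope Y
      c = col v
      nonempty : ∃[ i ] i ∈ Q ∖ v
      nonempty with #-pos⇒∈ {Q ∖ v} (not c) (subst (1 ℕ.≤_) (trans (sym (balanced (not c))) (#-∖-other {Q} (Bool.not-¬ refl))) 1≤k)
      ... | i , i∈ , _ = i , i∈
      by-group : ∃[ q ] q ∈ Q ∖ v × (∀ i → i ∈ Q ∖ v → s q ≤ᵣ s i) → BalancedCut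
      by-group (q , q∈ , steepest) = by-balance (# (not c) on G ℕ.≤? # c on G)
        where
        group : FinSet n
        group i = ⌊ s i ≟ s q ⌋
        G = (Q ∖ v) ∩ group
        H = (Q ∖ v) ∩ ∁ group
        group⁺ : ∀ {i} → s i ≡ s q → i ∈ group
        group⁺ eq = mem (fromWitness eq)
        group⁻ : ∀ {i} → i ∈ group → s i ≡ s q
        group⁻ (mem e) = toWitness e
        steeper : ∀ {i} → i ∈ Q ∖ v → ¬ i ∈ G → s q <ᵣ s i
        steeper {i} i∈ i∉G = ≤∧≢⇒< (steepest i i∈) (λ eq → i∉G (∩⁺ i∈ (group⁺ (sym eq))))
        totals : suc (# c on G ℕ.+ # c on H) ≡ # (not c) on G ℕ.+ # (not c) on H
        totals = begin
          suc (# c on G ℕ.+ # c on H)             ≡⟨ cong suc (sym (#-split c (Q ∖ v) group)) ⟩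
          suc (# c on (Q ∖ v))                    ≡⟨ sym (#-∖-same v∈Q) ⟩
          # c on Q                                ≡⟨ trans (balanced c) (sym (balanced (not c))) ⟩
          # (not c) on Q                          ≡⟨ #-∖-other {Q} (Bool.not-¬ refl) ⟩
          # (not c) on (Q ∖ v)                    ≡⟨ #-split (not c) (Q ∖ v) group ⟩
          # (not c) on G ℕ.+ # (not c) on H       ∎
          where open ≡-Reasoning
        L = combine 1ᵣ Y (-ᵣ s q) X 0ᵣ
        at-L : ∀ i → L at i ≡ Y at i - s q · X at i
        at-L i = trans (at-combine 1ᵣ Y (-ᵣ s q) X 0ᵣ i) (trans (+-identityʳ _) (trans (cong (_+ (-ᵣ s q) · X at i) (*-identityˡ _))
          (solve 3 (λ y s x → y :+ (:- s) :* x := y :- s :* x) refl (Y at i) (s q) (X at i))))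
        L-nondegenerate : Nondegenerate L
        L-nondegenerate (a≡0 , b≡0) = 0≢1 (trans (sym a≡0) (trans (cong (λ z → 1ᵣ · 1ᵣ + z · tilt) -s≡0)
            (trans (cong₂ _+_ (*-identityˡ 1ᵣ) (zeroˡ tilt)) (+-identityʳ 1ᵣ))))
          where
          -s≡0 : -ᵣ s q ≡ 0ᵣ
          -s≡0 = trans (sym (*-identityʳ _)) (trans (sym (+-identityˡ _)) (trans (cong (_+ (-ᵣ s q) · 1ᵣ) (sym (*-identityˡ 0ᵣ))) b≡0))
        Lv≡0 : L at v ≡ 0ᵣ
        Lv≡0 = trans (at-combine 1ᵣ Y (-ᵣ s q) X 0ᵣ v) (trans (+-identityʳ _) (0+0 (vertical-at v) (above-self v)))
        L-on-G : ∀ {i} → i ∈ G → L at i ≡ 0ᵣ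
        L-on-G {i} i∈G = trans (at-L i) (x≈y⇒x∙y⁻¹≈ε (trans (sym (slope-· Y (proj₂ (∖⁻ {P = Q} (proj₁ (∩⁻ {P = Q ∖ v} i∈G))))))
          (cong (_· X at i) (group⁻ (proj₂ (∩⁻ {P = Q ∖ v} i∈G))))))
        slope-neg : ∀ i → slope (scale (-ᵣ 1ᵣ) Y) i ≡ -ᵣ s i
        slope-neg i = trans (cong (_· inv (X at i)) (at-scale (-ᵣ 1ᵣ) Y i))
          (trans (solve 3 (λ o y i → (:- o) :* y :* i := o :* (:- (y :* i))) refl 1ᵣ (Y at i) (inv (X at i))) (*-identityˡ _))
        by-balance : Dec (# (not c) on G ℕ.≤ # c on G) → BalancedCut
        by-balance (yes c̄≤c) = pencil-cut Y H (vertical-at v) (λ i → proj₁ ∘ ∩⁻ {P = Q ∖ v})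
          (λ {i} {j} i∈ i∉H j∈H → subst (_<ᵣ s j) (sym (outside i∈ i∉H))
            (steeper (proj₁ (∩⁻ {P = Q ∖ v} j∈H)) λ j∈G → ∁⁻ (proj₂ (∩⁻ {P = Q ∖ v} j∈H)) (proj₂ (∩⁻ {P = Q ∖ v} j∈G))))
          (ℕ.+-cancelˡ-≤ (# c on G) _ _ (ℕ.≤-trans (ℕ.≤-reflexive (trans (ℕ.+-suc (# c on G) (# c on H)) totals)) (ℕ.+-monoˡ-≤ _ c̄≤c)))
          q∈ λ q∈H → ∁⁻ (proj₂ (∩⁻ {P = Q ∖ v} q∈H)) (group⁺ refl)
          where
          outside : ∀ {i} → i ∈ Q ∖ v → ¬ i ∈ H → s i ≡ s q
          outside {i} i∈ i∉H with i ∈? group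
          ... | yes i∈group = group⁻ i∈group
          ... | no  i∉group = contradiction (∩⁺ i∈ (∁⁺ i∉group)) i∉H
        -- Negating Y reverses the rotation, so that `G` comes last and is a final segment.
        by-balance (no c̄≰c) with off-line-point L ¬col L-nondegenerate
        ... | w , w∈Q , Lw≢0 = pencil-cut (scale (-ᵣ 1ᵣ) Y) G
          (trans (at-scale (-ᵣ 1ᵣ) Y v) (trans (cong ((-ᵣ 1ᵣ) ·_) (vertical-at v)) (zeroʳ _)))
          (λ i → proj₁ ∘ ∩⁻ {P = Q ∖ v})
          (λ {i} {j} i∈ i∉G j∈G → subst₂ _<ᵣ_ (sym (slope-neg i)) (sym (slope-neg j))
            (0<-⇒< (subst Positive (trans (cong (λ z → s i - z) (sym (group⁻ (proj₂ (∩⁻ {P = Q ∖ v} j∈G)))))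
              (solve 2 (λ a b → a :- b := :- b :- :- a) refl (s i) (s j))) (<⇒0<- (steeper i∈ i∉G)))))
          (ℕ.≰⇒> c̄≰c) (∖⁺ {P = Q} w∈Q λ { refl → Lw≢0 Lv≡0 }) (Lw≢0 ∘ L-on-G)

-- The lower bound k + 1 by induction on the number of points

module LowerBound (R : RealField) {n : ℕ} (p : Fin n → Plane.Point R) (p-inj : Injective _≡_ _≡_ p)
                  (col : Fin n → Bool) where
  open Cutting R p p-inj col public

  needs-≤ : ∀ {Q k l} → k ℕ.≤ l → NeedsBlockers Q l → NeedsBlockers Q k
  needs-≤ k≤l needs C blocks = ℕ.≤-trans k≤l (needs C blocks)

  record Separation (Q A B : FinSet n) : Set where
    field
      φ     : Form
      A⊆Q   : A ⊆ Q
      B⊆Q   : B ⊆ Q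
      cover : ∀ {i} → i ∈ Q → i ∈ A ⊎ i ∈ B
      φ≤0   : ∀ {i} → i ∈ A → φ at i ≤ᵣ 0ᵣ
      0<φ   : ∀ {i} → i ∈ B → Positive (φ at i)

  module _ {Q A B : FinSet n} (sep : Separation Q A B) where
    open Separation sep

    -- Only finitely many points matter, so for large M the line M φ = 1 separates the same two
    -- sets, with B strictly on one side and A, including its points on φ = 0, strictly on the
    -- other.
    flip : Separation Q B A
    flip = record { φ = φ′ ; A⊆Q = B⊆Q ; B⊆Q = A⊆Q ; cover = Sum.swap ∘ cover
                  ; φ≤0 = φ′≤0 ; 0<φ = 0<φ′ ∘ φ≤0 }
      where
      scaling = upper-bound (λ i → ratio (φ at i) (-ᵣ 1ᵣ))
      M = proj₁ scaling
      bound = proj₂ scaling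
      φ′ = combine (-ᵣ M) φ 0ᵣ φ 1ᵣ
      at-φ′ : ∀ i → φ′ at i ≡ -ᵣ (M · φ at i + -ᵣ 1ᵣ)
      at-φ′ i = trans (at-combine (-ᵣ M) φ 0ᵣ φ 1ᵣ i) (trans
        (cong (λ z → (-ᵣ M) · φ at i + z + 1ᵣ) (zeroˡ (φ at i))) (trans (cong (_+ 1ᵣ) (+-identityʳ _))
        (solve 3 (λ m f o → (:- m) :* f :+ o := :- (m :* f :+ :- o)) refl M (φ at i) 1ᵣ)))
      φ′≤0 : ∀ {i} → i ∈ B → φ′ at i ≤ᵣ 0ᵣ
      φ′≤0 {i} i∈B = subst (_≤ᵣ 0ᵣ) (sym (at-φ′ i)) (<⇒≤ (pos⇒-<0 (dominate-pos (bound i) (0<φ i∈B))))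
      0<φ′ : ∀ {i} → φ at i ≤ᵣ 0ᵣ → Positive (φ′ at i)
      0<φ′ {i} φi≤0 = subst Positive (sym (at-φ′ i)) (neg⇒0<- (negative (compare (φ at i) 0ᵣ)))
        where
        negative : Tri (φ at i <ᵣ 0ᵣ) (φ at i ≡ 0ᵣ) (0ᵣ <ᵣ φ at i) → M · φ at i + -ᵣ 1ᵣ <ᵣ 0ᵣ
        negative (tri< φi<0 _ _) = dominate-neg (bound i) φi<0
        negative (tri> _ _ 0<φi) = contradiction 0<φi φi≤0
        negative (tri≈ _ φi≡0 _) = subst (_<ᵣ 0ᵣ)
          (sym (trans (cong (λ z → M · z + -ᵣ 1ᵣ) φi≡0) (trans (cong (_+ -ᵣ 1ᵣ) (zeroʳ M)) (+-identityˡ _)))) (pos⇒-<0 0<1)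

    -- Ordering by φ with ties broken by `height` amounts to a slight turn of the line. All of A
    -- comes before B, so the line can pass exactly one point of B, the nearest in this order.
    shift : ∃[ i ] i ∈ B → ∃[ z ] z ∈ B × Separation Q (Q ∩ ∁ (B ∖ z)) (B ∖ z)
    shift (i , i∈B) = from-nearest (argmin B κ (i , i∈B))
      where
      refinement = refine (φ at_) (height at_) (λ _ → height-injective)
      M = proj₁ refinement
      κ : Fin n → Carrier
      κ i = M · φ at i + height at i
      from-nearest : ∃[ z ] z ∈ B × (∀ i → i ∈ B → κ z ≤ᵣ κ i) → ∃[ z ] z ∈ B × Separation Q (Q ∩ ∁ (B ∖ z)) (B ∖ z)
      from-nearest (z , z∈B , nearest) = z , z∈B , record
        { φ = ψ ; A⊆Q = λ i → proj₁ ∘ ∩⁻ ; B⊆Q = λ i i∈ → B⊆Q i (proj₁ (∖⁻ {P = B} i∈))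
        ; cover = cover′ ; φ≤0 = ψ≤0 ; 0<φ = 0<ψ }
        where
        ψ = combine M φ 1ᵣ height (-ᵣ κ z)
        at-ψ : ∀ i → ψ at i ≡ κ i - κ z
        at-ψ i = trans (at-combine M φ 1ᵣ height (-ᵣ κ z) i) (cong (λ u → M · φ at i + u - κ z) (*-identityˡ _))
        cover′ : ∀ {i} → i ∈ Q → i ∈ Q ∩ ∁ (B ∖ z) ⊎ i ∈ B ∖ z
        cover′ {i} i∈Q with i ∈? (B ∖ z)
        ... | yes i∈ = inj₂ i∈
        ... | no  i∉ = inj₁ (∩⁺ i∈Q (∁⁺ i∉))
        ψ≤0 : ∀ {i} → i ∈ Q ∩ ∁ (B ∖ z) → ψ at i ≤ᵣ 0ᵣ
        ψ≤0 {i} i∈ 0<ψi with cover (proj₁ (∩⁻ {P = Q} i∈)) | i Fin.≟ z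
        ... | _         | yes refl = irrefl (subst Positive (trans (at-ψ i) (-‿inverseʳ _)) 0<ψi)
        ... | inj₂ i∈B  | no i≢z   = ∁⁻ (proj₂ (∩⁻ {P = Q} i∈)) (∖⁺ {P = B} i∈B i≢z)
        ... | inj₁ i∈A  | no _     = irrefl (<-trans (proj₂ (proj₂ refinement) (≤-<-trans (φ≤0 i∈A) (0<φ z∈B)))
                                       (0<-⇒< (subst Positive (at-ψ i) 0<ψi)))
        0<ψ : ∀ {i} → i ∈ B ∖ z → Positive (ψ at i)
        0<ψ {i} i∈ with ∖⁻ {P = B} i∈
        ... | i∈B , i≢z = subst Positive (sym (at-ψ i)) (<⇒0<- (≤∧≢⇒< (nearest i i∈B)
                (λ eq → i≢z (sym (proj₁ (proj₂ refinement) eq)))))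

    -- Q is not collinear, so some point of A is off the line of B and the fan applies. A collinear
    -- side thus contributes `suc k₂`, as much as induction would give for a non-collinear one.
    needs-collinear-side : ∀ {k₁ k₂} → ¬ Collinear Q → Collinear B → NeedsBlockers A k₁ →
      1 ℕ.≤ k₂ → (∀ c → k₂ ℕ.≤ # c on B) → NeedsBlockers Q (k₁ ℕ.+ suc k₂)
    needs-collinear-side ¬col (ℓ , nd , ℓ≡0) needs 1≤k₂ k₂≤# with off-line-point ℓ ¬col nd
    ... | s , s∈Q , ℓs≢0 with cover s∈Q
    ...   | inj₁ s∈A = needs-off-line A⊆Q B⊆Q ℓ (ℓ≡0 _) φ φ≤0 0<φ s∈A ℓs≢0 needs 1≤k₂ k₂≤#
    ...   | inj₂ s∈B = contradiction (ℓ≡0 s s∈B) ℓs≢0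

  separate : ∀ Q φ → Separation Q (Q ∩ ∁ (positive φ)) (Q ∩ positive φ)
  separate Q φ = record
    { φ = φ ; A⊆Q = λ i → proj₁ ∘ ∩⁻ ; B⊆Q = λ i → proj₁ ∘ ∩⁻ ; cover = cover
    ; φ≤0 = λ i∈ 0<φi → ∁⁻ (proj₂ (∩⁻ {P = Q} i∈)) (positive⁺ {φ} 0<φi)
    ; 0<φ = λ i∈ → positive⁻ {φ} (proj₂ (∩⁻ {P = Q} i∈)) }
    where
    cover : ∀ {i} → i ∈ Q → i ∈ Q ∩ ∁ (positive φ) ⊎ i ∈ Q ∩ positive φ
    cover {i} i∈Q with i ∈? positive φ
    ... | yes i∈ = inj₂ (∩⁺ i∈Q i∈)
    ... | no  i∉ = inj₁ (∩⁺ i∈Q (∁⁺ i∉))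

  -- The one way in which moving a point z of B to A can fail to help: A and z together are still
  -- collinear.
  ExtendedLine : FinSet n → FinSet n → Set
  ExtendedLine A B = ∃[ z ] z ∈ B × ∃[ ℓ ] Nondegenerate ℓ × ℓ at z ≡ 0ᵣ × (∀ i → i ∈ A → ℓ at i ≡ 0ᵣ)

  -- The induction hypothesis of needs-suc.
  SmallerNeed : FinSet n → Set
  SmallerNeed Q = ∀ {Q′ w k} → w ∈ Q → Q′ ⊆ Q ∖ w → 1 ℕ.≤ k → (∀ c → k ℕ.≤ # c on Q′) → ¬ Collinear Q′ →
    NeedsBlockers Q′ (suc k)

  module _ {Q : FinSet n} (¬col : ¬ Collinear Q) (smaller : SmallerNeed Q) where

    needs-unbalanced : ∀ {k c} → 1 ℕ.≤ k → (∀ c → k ℕ.≤ # c on Q) → k ℕ.< # c on Q → NeedsBlockers Q (suc k)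
    needs-unbalanced {k} {c} 1≤k k≤# k<# with #-pos⇒∈ {Q} c (ℕ.≤-trans (s≤s z≤n) k<#)
    ... | r , r∈Q , refl = by-cases (collinear? (Q ∖ r))
      where
      k≤#′ : ∀ c → k ℕ.≤ # c on (Q ∖ r)
      k≤#′ c with col r Bool.≟ c
      ... | yes refl = ℕ.s≤s⁻¹ (subst (suc k ℕ.≤_) (#-∖-same r∈Q) k<#)
      ... | no cr≢c  = subst (k ℕ.≤_) (#-∖-other {Q} cr≢c) (k≤# c)
      by-cases : Dec (Collinear (Q ∖ r)) → NeedsBlockers Q (suc k)
      by-cases (no ¬col′) = needs-⊆ (λ i → proj₁ ∘ ∖⁻ {P = Q}) (smaller r∈Q (λ i → id) 1≤k k≤#′ ¬col′)
      by-cases (yes (ℓ , nd , ℓ≡0)) = needs-off-line {Q₁ = ⁅ r ⁆} {Q ∖ r}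
          (λ i i∈ → subst (_∈ Q) (sym (⁅⁆⁻ i∈)) r∈Q) (λ i → proj₁ ∘ ∖⁻ {P = Q}) ℓ (ℓ≡0 _)
          φ (λ {i} i∈ → subst (λ i → φ at i ≤ᵣ 0ᵣ) (sym (⁅⁆⁻ i∈)) φr≤0) 0<φ (⁅⁆⁺ refl) ℓr≢0 needs-0 1≤k k≤#′
        where
        ℓr≢0 : ℓ at r ≢ 0ᵣ
        ℓr≢0 ℓr≡0 = ¬col (ℓ , nd , on-ℓ)
          where
          on-ℓ : ∀ i → i ∈ Q → ℓ at i ≡ 0ᵣ
          on-ℓ i i∈Q with i Fin.≟ r
          ... | yes refl = ℓr≡0
          ... | no  i≢r  = ℓ≡0 i (∖⁺ {P = Q} i∈Q i≢r)
        -- The parallel to ℓ through r, with the sign that makes it positive on ℓ.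
        φ = combine (-ᵣ (ℓ at r)) ℓ 0ᵣ ℓ (ℓ at r · ℓ at r)
        at-φ : ∀ i → φ at i ≡ ℓ at r · ℓ at r - ℓ at r · ℓ at i
        at-φ i = trans (at-combine (-ᵣ (ℓ at r)) ℓ 0ᵣ ℓ (ℓ at r · ℓ at r) i) (trans
          (cong (λ z → (-ᵣ (ℓ at r)) · ℓ at i + z + ℓ at r · ℓ at r) (zeroˡ (ℓ at i)))
          (trans (cong (_+ ℓ at r · ℓ at r) (+-identityʳ _))
            (solve 2 (λ r i → (:- r) :* i :+ r :* r := r :* r :- r :* i) refl (ℓ at r) (ℓ at i))))
        φr≤0 : φ at r ≤ᵣ 0ᵣ
        φr≤0 = subst (_≤ᵣ 0ᵣ) (sym (trans (at-φ r) (-‿inverseʳ _))) irrefl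
        0<φ : ∀ {i} → i ∈ Q ∖ r → Positive (φ at i)
        0<φ {i} i∈ = subst Positive (sym (trans (at-φ i) (trans
          (cong (λ z → ℓ at r · ℓ at r - z) (trans (cong (ℓ at r ·_) (ℓ≡0 i i∈)) (zeroʳ _))) (x-0≡x _)))) (≢0⇒0<² ℓr≢0)

    -- With z moved, the side of A is non-collinear and counts `suc k₁` by induction, while B
    -- without z keeps at least k₂ - 1 ≥ 1 points of each colour and so counts k₂.
    needs-two-lines : ∀ {A B k₁ k₂} → Separation Q A B → Collinear B → 1 ℕ.≤ k₁ → 2 ℕ.≤ k₂ →
      (∀ c → k₁ ℕ.≤ # c on A) → (∀ c → k₂ ℕ.≤ # c on B) →
      NeedsBlockers Q (suc k₁ ℕ.+ k₂) ⊎ ExtendedLine A B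
    needs-two-lines {A} {B} {k₁} {suc k₂} sep (ℓ , nd , ℓ≡0) 1≤k₁ (s≤s 1≤k₂) k₁≤# k₂≤# =
      from-shift (shift sep (nonempty (#-pos⇒∈ {B} true (ℕ.≤-trans (s≤s z≤n) (k₂≤# true)))))
      where
      open Separation sep
      Result = NeedsBlockers Q (suc k₁ ℕ.+ suc k₂) ⊎ ExtendedLine A B
      nonempty : ∃[ i ] i ∈ B × col i ≡ true → ∃[ i ] i ∈ B
      nonempty (i , i∈B , _) = i , i∈B
      from-shift : ∃[ z ] z ∈ B × Separation Q (Q ∩ ∁ (B ∖ z)) (B ∖ z) → Result
      from-shift (z , z∈B , sep′) = by-cases (collinear? A′)
        where
        A′ = Q ∩ ∁ (B ∖ z)
        A⊆A′ : A ⊆ A′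
        A⊆A′ i i∈A = ∩⁺ (A⊆Q i i∈A) (∁⁺ λ i∈ → φ≤0 i∈A (0<φ (proj₁ (∖⁻ {P = B} i∈))))
        k₁≤#′ : ∀ c → k₁ ℕ.≤ # c on A′
        k₁≤#′ c = ℕ.≤-trans (k₁≤# c) (count-⊆ {P = A ∩ coloured c} {A′ ∩ coloured c}
          λ i i∈ → ∩⁺ {P = A′} (A⊆A′ i (proj₁ (∩⁻ {P = A} i∈))) (proj₂ (∩⁻ {P = A} i∈)))
        k₂≤#′ : ∀ c → k₂ ℕ.≤ # c on (B ∖ z)
        k₂≤#′ c = ℕ.s≤s⁻¹ (ℕ.≤-trans (k₂≤# c) (#-∖-suc {B} c z∈B))
        needs-A′ : ¬ Collinear A′ → ∃[ w ] w ∈ B ∖ z × col w ≡ true → NeedsBlockers A′ (suc k₁)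
        needs-A′ ¬col′ (w , w∈ , _) = smaller (B⊆Q w (proj₁ (∖⁻ {P = B} w∈)))
          (λ i i∈ → ∖⁺ {P = Q} (proj₁ (∩⁻ {P = Q} i∈)) λ { refl → ∁⁻ (proj₂ (∩⁻ {P = Q} i∈)) w∈ }) 1≤k₁ k₁≤#′ ¬col′
        by-cases : Dec (Collinear A′) → Result
        by-cases (yes (ℓ′ , nd′ , ℓ′≡0)) = inj₂ (z , z∈B , ℓ′ , nd′ ,
          ℓ′≡0 z (∩⁺ (B⊆Q z z∈B) (∁⁺ λ z∈ → proj₂ (∖⁻ {P = B} z∈) refl)) , λ i i∈A → ℓ′≡0 i (A⊆A′ i i∈A))
        by-cases (no ¬col′) = inj₁ (needs-collinear-side sep′ ¬col (ℓ , nd , λ i i∈ → ℓ≡0 i (proj₁ (∖⁻ {P = B} i∈)))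
          (needs-A′ ¬col′ (#-pos⇒∈ {B ∖ z} true (ℕ.≤-trans 1≤k₂ (k₂≤#′ true)))) 1≤k₂ k₂≤#′)

    -- If one of the counts is 1, the single blocker of `needs-1` is already the full count of that
    -- side. Otherwise a point can usefully be moved in one of the two directions.
    needs-collinear-sides : ∀ {A B k₁ k₂} → Separation Q A B → Collinear A → Collinear B → 1 ℕ.≤ k₁ → 1 ℕ.≤ k₂ →
      (∀ c → k₁ ℕ.≤ # c on A) → (∀ c → k₂ ℕ.≤ # c on B) → NeedsBlockers Q (suc k₁ ℕ.+ k₂)
    needs-collinear-sides {A} {B} {k₁} {k₂} sep colA colB 1≤k₁ 1≤k₂ k₁≤# k₂≤# = by-size (2 ℕ.≤? k₁) (2 ℕ.≤? k₂)
      where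
      open Separation sep
      by-shift : NeedsBlockers Q (suc k₁ ℕ.+ k₂) ⊎ ExtendedLine A B → NeedsBlockers Q (suc k₂ ℕ.+ k₁) ⊎ ExtendedLine B A →
        NeedsBlockers Q (suc k₁ ℕ.+ k₂)
      by-shift (inj₁ needs) _ = needs
      by-shift (inj₂ _) (inj₁ needs) = needs-≤ (s≤s (ℕ.≤-reflexive (ℕ.+-comm k₁ k₂))) needs
      -- Both moves fail: A and z lie on ℓ, B and q on ℓ′. The distinct points z and q lie on both
      -- lines, so the lines agree and contain Q.
      by-shift (inj₂ (z , z∈B , ℓ , nd , ℓz , ℓA)) (inj₂ (q , q∈A , ℓ′ , nd′ , ℓ′q , ℓ′B)) = contradiction (ℓ′ , nd′ , on-ℓ′) ¬col
        where
        z≢q : z ≢ q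
        z≢q refl = φ≤0 q∈A (0<φ z∈B)
        on-ℓ′ : ∀ i → i ∈ Q → ℓ′ at i ≡ 0ᵣ
        on-ℓ′ i i∈Q with cover i∈Q
        ... | inj₁ i∈A = line-unique ℓ ℓ′ nd z≢q ℓz (ℓA q q∈A) (ℓ′B z z∈B) ℓ′q (ℓA i i∈A)
        ... | inj₂ i∈B = ℓ′B i i∈B
      by-size : Dec (2 ℕ.≤ k₁) → Dec (2 ℕ.≤ k₂) → NeedsBlockers Q (suc k₁ ℕ.+ k₂)
      by-size (no 2≰k₁) _ = needs-≤ (s≤s (ℕ.+-monoˡ-≤ k₂ (ℕ.s≤s⁻¹ (ℕ.≰⇒> 2≰k₁))))
        (needs-collinear-side sep ¬col colB (needs-1 {A} λ c → ℕ.≤-trans 1≤k₁ (k₁≤# c)) 1≤k₂ k₂≤#)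
      by-size (yes _) (no 2≰k₂) = needs-≤ (s≤s (ℕ.≤-trans (ℕ.+-monoʳ-≤ k₁ (ℕ.s≤s⁻¹ (ℕ.≰⇒> 2≰k₂))) (ℕ.≤-reflexive (ℕ.+-comm k₁ 1))))
        (needs-collinear-side (flip sep) ¬col colA (needs-1 {B} λ c → ℕ.≤-trans 1≤k₂ (k₂≤# c)) 1≤k₁ k₁≤#)
      by-size (yes 2≤k₁) (yes 2≤k₂) = by-shift (needs-two-lines sep colB 1≤k₁ 2≤k₂ k₁≤# k₂≤#)
        (needs-two-lines (flip sep) colA 1≤k₂ 2≤k₁ k₂≤# k₁≤#)

    needs-balanced : ∀ {k} → 1 ℕ.≤ k → (∀ c → # c on Q ≡ k) → NeedsBlockers Q (suc k)
    needs-balanced {k} 1≤k balanced = from-cut (balanced-cut Q k balanced 1≤k ¬col)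
      where
      from-cut : BalancedCut Q k balanced → NeedsBlockers Q (suc k)
      from-cut cut = by-cases (collinear? A) (collinear? B)
        where
        open BalancedCut cut
        A = Q ∩ ∁ (positive φ)
        B = Q ∩ positive φ
        sep = separate Q φ
        open Separation sep using (φ≤0; 0<φ; A⊆Q; B⊆Q)
        k⁻≤# : ∀ c → k⁻ ℕ.≤ # c on A
        k⁻≤# c = ℕ.≤-reflexive (sym (#⁻ c))
        k⁺≤# : ∀ c → k⁺ ℕ.≤ # c on B
        k⁺≤# c = ℕ.≤-reflexive (sym (#⁺ c))
        needs-A : ¬ Collinear A → NeedsBlockers A (suc k⁻)
        needs-A ¬colA with #-pos⇒∈ {B} true (ℕ.≤-trans 1≤k⁺ (k⁺≤# true))
        ... | w , w∈B , _ = smaller (B⊆Q w w∈B) (λ i i∈A → ∖⁺ {P = Q} (A⊆Q i i∈A) λ { refl → φ≤0 i∈A (0<φ w∈B) }) 1≤k⁻ k⁻≤# ¬colA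
        needs-B : ¬ Collinear B → NeedsBlockers B (suc k⁺)
        needs-B ¬colB with #-pos⇒∈ {A} true (ℕ.≤-trans 1≤k⁻ (k⁻≤# true))
        ... | w , w∈A , _ = smaller (A⊆Q w w∈A) (λ i i∈B → ∖⁺ {P = Q} (B⊆Q i i∈B) λ { refl → φ≤0 w∈A (0<φ i∈B) }) 1≤k⁺ k⁺≤# ¬colB
        -- Two gains of one make the total one larger than asked; only when both parts are collinear
        -- is there nothing to spare.
        enough : suc k ℕ.≤ suc k⁻ ℕ.+ suc k⁺
        enough = s≤s (ℕ.≤-trans (ℕ.≤-reflexive (sym sum)) (ℕ.+-monoʳ-≤ k⁻ (ℕ.n≤1+n k⁺)))
        enough′ : suc k ℕ.≤ suc k⁺ ℕ.+ suc k⁻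
        enough′ = ℕ.≤-trans enough (ℕ.≤-reflexive (ℕ.+-comm (suc k⁻) (suc k⁺)))
        by-cases : Dec (Collinear A) → Dec (Collinear B) → NeedsBlockers Q (suc k)
        by-cases (no ¬colA) (no ¬colB) = needs-≤ enough (needs-cut φ A⊆Q B⊆Q φ≤0 0<φ (needs-A ¬colA) (needs-B ¬colB))
        by-cases (no ¬colA) (yes colB) = needs-≤ enough (needs-collinear-side sep ¬col colB (needs-A ¬colA) 1≤k⁺ k⁺≤#)
        by-cases (yes colA) (no ¬colB) = needs-≤ enough′ (needs-collinear-side (flip sep) ¬col colA (needs-B ¬colB) 1≤k⁻ k⁻≤#)
        by-cases (yes colA) (yes colB) = needs-≤ (s≤s (ℕ.≤-reflexive (sym sum)))
          (needs-collinear-sides sep colA colB 1≤k⁻ 1≤k⁺ k⁻≤# k⁺≤#)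

  needs-suc : ∀ N {Q k} → count Q ℕ.≤ N → 1 ℕ.≤ k → (∀ c → k ℕ.≤ # c on Q) → ¬ Collinear Q → NeedsBlockers Q (suc k)
  needs-suc zero {Q} |Q|≤0 1≤k k≤# ¬col with #-pos⇒∈ {Q} true (ℕ.≤-trans 1≤k (k≤# true))
  ... | i , i∈Q , _ = contradiction (ℕ.≤-trans (∈⇒0<count i∈Q) |Q|≤0) λ ()
  needs-suc (suc N) {Q} {k} |Q|≤N 1≤k k≤# ¬col = by-balance (k ℕ.≟ # true on Q) (k ℕ.≟ # false on Q)
    where
    smaller : SmallerNeed Q
    smaller w∈Q Q′⊆ = needs-suc N (ℕ.s≤s⁻¹ (ℕ.≤-trans (s≤s (count-⊆ Q′⊆)) (subst (ℕ._≤ suc N) (count-∖ w∈Q) |Q|≤N)))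
    by-balance : Dec (k ≡ # true on Q) → Dec (k ≡ # false on Q) → NeedsBlockers Q (suc k)
    by-balance (yes eq₁) (yes eq₂) = needs-balanced ¬col smaller 1≤k λ { true → sym eq₁ ; false → sym eq₂ }
    by-balance (no neq) _ = needs-unbalanced ¬col smaller {c = true} 1≤k k≤# (ℕ.≤∧≢⇒< (k≤# true) neq)
    by-balance (yes _) (no neq) = needs-unbalanced ¬col smaller {c = false} 1≤k k≤# (ℕ.≤∧≢⇒< (k≤# false) neq)

-- Subsets as vectors and the halving of degrees

full : ∀ {n} → FinSet n
full _ = true

count-full : ∀ n → count (full {n}) ≡ n
count-full zero    = refl
count-full (suc n) = cong suc (count-full n)

∣∣≡count : ∀ {n} (S : Subset.Subset n) → Subset.∣ S ∣ ≡ count (lookup S)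
∣∣≡count []          = refl
∣∣≡count (true  ∷ S) = cong suc (∣∣≡count S)
∣∣≡count (false ∷ S) = ∣∣≡count S

∈-subset⁺ : ∀ {n} {S : Subset.Subset n} {i} → i ∈ lookup S → i Subset.∈ S
∈-subset⁺ {S = S} {i} (mem i∈S) = lookup⇒[]= i S (Equivalence.to Bool.T-≡ i∈S)

∈-subset⁻ : ∀ {n} {S : Subset.Subset n} {i} → i Subset.∈ S → i ∈ lookup S
∈-subset⁻ {S = S} {i} i∈S = mem (Equivalence.from Bool.T-≡ ([]=⇒lookup i∈S))

2*⌈n/2⌉≤1+n : ∀ n → ℕ.⌈ n /2⌉ ℕ.+ ℕ.⌈ n /2⌉ ℕ.≤ suc n
2*⌈n/2⌉≤1+n n = ℕ.≤-trans (ℕ.+-monoʳ-≤ ℕ.⌈ n /2⌉ (ℕ.⌈n/2⌉-mono (ℕ.n≤1+n n))) (ℕ.≤-reflexive (ℕ.⌊n/2⌋+⌈n/2⌉≡n (suc n)))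

n≤2*⌈n/2⌉ : ∀ n → n ℕ.≤ ℕ.⌈ n /2⌉ ℕ.+ ℕ.⌈ n /2⌉
n≤2*⌈n/2⌉ n = ℕ.≤-trans (ℕ.≤-reflexive (sym (ℕ.⌊n/2⌋+⌈n/2⌉≡n n))) (ℕ.+-monoˡ-≤ ℕ.⌈ n /2⌉ (ℕ.⌊n/2⌋≤⌈n/2⌉ n))

-- For n at most 1 the bound `n < m` is too weak and `3 ≤ m` takes over; from 2 on, halving saves
-- enough.
1+⌈n/2⌉<m : ∀ n {m} → 3 ℕ.≤ m → n ℕ.< m → suc ℕ.⌈ n /2⌉ ℕ.< m
1+⌈n/2⌉<m zero          3≤m _   = ℕ.≤-trans (s≤s (s≤s z≤n)) 3≤m
1+⌈n/2⌉<m (suc zero)    3≤m _   = 3≤m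
1+⌈n/2⌉<m (suc (suc n)) _   n<m = ℕ.≤-trans (s≤s (s≤s (s≤s (ℕ.⌈n/2⌉≤n n)))) n<m

-- Visibility and the component of a vertex outside a separator

module Visibility (R : RealField) {n : ℕ} (p : Fin n → Plane.Point R) (p-inj : Injective _≡_ _≡_ p) where
  open Geometry R p p-inj
  open Plane.PointSet R p hiding (Collinear)

  3≤n : ¬ Collinear full → 3 ℕ.≤ n
  3≤n ¬col with off-line-point (form 1ᵣ 0ᵣ 0ᵣ) ¬col (λ (1≡0 , _) → 0≢1 (sym 1≡0))
  ... | i , _ , _ with off-line-point (vertical i) ¬col (vertical-nondegenerate i)
  ...   | j , _ , j∉vertical with off-line-point (line i j) ¬col (line-nondegenerate i≢j)
    where
    i≢j : i ≢ j
    i≢j refl = j∉vertical (vertical-at i)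
  ...     | k , _ , k∉line = subst (3 ℕ.≤_) (trans (sym (count-∖ {P = full} {i} _)) (count-full n))
              (s≤s (subst (2 ℕ.≤_) (sym (count-∖ {P = full ∖ i} {j} (∖⁺ {P = full} _ λ { refl → j∉vertical (vertical-at i) })))
                (s≤s (∈⇒0<count {P = (full ∖ i) ∖ j} {k} (∖⁺ {P = full ∖ i} (∖⁺ {P = full} _ λ { refl → k∉line (line-source i j) })
                  λ { refl → k∉line (line-target i j) })))))

  visible? : ∀ {i j} → i ≢ j → Visible i j ⊎ (∃[ k ] Between i j k)
  visible? i≢j with forall? full (λ k → ¬? (between? i≢j k))
  ... | inj₁ none = inj₁ λ (k , k∈ij) → none k _ k∈ij
  ... | inj₂ (k , _ , k∈ij) = inj₂ (k , decidable-stable (between? i≢j k) k∈ij)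

  adj? : ∀ i j → Dec (Adj i j)
  adj? i j with i Fin.≟ j
  ... | yes i≡j = no λ (i≢j , _) → i≢j i≡j
  ... | no  i≢j with visible? i≢j
  ...   | inj₁ visible = yes (i≢j , visible)
  ...   | inj₂ blocked = no λ (_ , visible) → visible blocked

  degree<n : ∀ {δ} → MinDegree≥ δ → ¬ Collinear full → δ ℕ.< n
  degree<n {δ} degree ¬col with off-line-point (form 1ᵣ 0ᵣ 0ᵣ) ¬col (λ (1≡0 , _) → 0≢1 (sym 1≡0))
  ... | i , _ with degree i
  ...   | f , f-inj , adj = subst (suc δ ℕ.≤_) (trans (sym (count-∖ {P = full} {i} _)) (count-full n))
            (s≤s (subst (ℕ._≤ count (full ∖ i)) (count-full δ) (pigeonhole full (full ∖ i) (λ r j → f r ≡ j)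
              (λ r _ → f r , ∖⁺ {P = full} _ (λ fr≡i → proj₁ (adj r) (sym fr≡i)) , refl)
              (λ _ _ eq eq′ → f-inj (trans eq (sym eq′))))))

  module Component (S : Subset.Subset n) {t : Fin n} (t∉S : t Subset.∉ S) where

    -- U is meant as the set of vertices not yet known to reach t.
    Reaching : FinSet n → Set
    Reaching U = ∀ i → ¬ i ∈ U → i Subset.∉ S × WalkAvoiding S i t

    Closed : FinSet n → Set
    Closed U = ∀ i j → i ∈ U → i Subset.∉ S → ¬ j ∈ U → ¬ Adj i j

    -- A vertex of U outside S that sees a vertex outside U reaches t through it and leaves U. Since
    -- U shrinks, this ends, and then nothing in U outside S sees the complement of U.
    component : ∀ N U → count U ℕ.≤ N → ¬ t ∈ U → Reaching U → ∃[ U′ ] ¬ t ∈ U′ × Reaching U′ × Closed U′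
    component N U |U|≤N t∉U reaching with forall? (U ∩ ∁ (lookup S)) (λ i → no-neighbour? i)
      where
      no-neighbour? : ∀ i → Dec (∀ j → j ∈ ∁ U → ¬ Adj i j)
      no-neighbour? i with forall? (∁ U) (λ j → ¬? (adj? i j))
      ... | inj₁ none = yes none
      ... | inj₂ (j , j∉U , ¬¬adj) = no λ none → ¬¬adj (none j j∉U)
    ... | inj₁ closed = U , t∉U , reaching , λ i j i∈U i∉S j∉U →
            closed i (∩⁺ i∈U (∁⁺ (i∉S ∘ ∈-subset⁺))) j (∁⁺ j∉U)
    ... | inj₂ (i , i∈ , neighbour) with forall? (∁ U) (λ j → ¬? (adj? i j))
    ...   | inj₁ none = contradiction none neighbour
    ...   | inj₂ (j , j∉U , ¬¬adj) = grow N |U|≤N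
      where
      i∈U = proj₁ (∩⁻ i∈)
      i∉S : i Subset.∉ S
      i∉S = ∁⁻ (proj₂ (∩⁻ {P = U} i∈)) ∘ ∈-subset⁻
      reaching′ : Reaching (U ∖ i)
      reaching′ k k∉ with k Fin.≟ i
      ... | yes refl = i∉S , step (decidable-stable (adj? i j) ¬¬adj) (proj₁ (reaching j (∁⁻ j∉U))) (proj₂ (reaching j (∁⁻ j∉U)))
      ... | no  k≢i  = reaching k λ k∈U → k∉ (∖⁺ {P = U} k∈U k≢i)
      grow : ∀ N → count U ℕ.≤ N → ∃[ U′ ] ¬ t ∈ U′ × Reaching U′ × Closed U′
      grow zero    |U|≤0 = contradiction (ℕ.≤-trans (∈⇒0<count i∈U) |U|≤0) λ ()
      grow (suc N) |U|≤N = component N (U ∖ i) (ℕ.s≤s⁻¹ (subst (ℕ._≤ suc N) (count-∖ i∈U) |U|≤N))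
        (t∉U ∘ proj₁ ∘ ∖⁻ {P = U}) reaching′

-- Minimum degree against the size of a separator

module Separator (R : RealField) {n : ℕ} (p : Fin n → Plane.Point R) (p-inj : Injective _≡_ _≡_ p)
                 (col : Fin n → Bool) (C : FinSet n) where
  open LowerBound R p p-inj col
  open Plane.PointSet R p hiding (Collinear)
  open Visibility R p p-inj

  Q : FinSet n
  Q = ∁ C

  module _ (separated : ∀ {i j} → i ∈ Q → j ∈ Q → col i ≢ col j → ¬ Adj i j) where

    between : ∀ {i j} → i ≢ j → FinSet n
    between i≢j k = ⌊ between? i≢j k ⌋

    Blocked : Fin n → Fin n → Set
    Blocked i j = ∃[ k ] k ∈ C × Between i j k

    ShorterBlocked : ℕ → Set
    ShorterBlocked m = ∀ {i j} (i≢j : i ≢ j) → count (between i≢j) ℕ.< m → i ∈ Q → j ∈ Q → col i ≢ col j → Blocked i j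

    -- The point k lies inside the longer segment but not inside the shorter one, so the number of
    -- interior points is a measure for the induction on bichromatic segments.
    between-shorter : ∀ {i j k i′ j′} (i≢j : i ≢ j) (i′≢j′ : i′ ≢ j′) → Between i j k →
      (∀ {l} → Between i′ j′ l → Between i j l × l ≢ k) → count (between i′≢j′) ℕ.< count (between i≢j)
    between-shorter {k = k} i≢j i′≢j′ k∈ij inside = subst (suc (count (between i′≢j′)) ℕ.≤_)
      (sym (count-∖ {P = between i≢j} {k} (mem (fromWitness k∈ij))))
      (s≤s (count-⊆ {P = between i′≢j′} {between i≢j ∖ k} λ l (mem l∈) → let l∈ij , l≢k = inside (toWitness l∈) in
        ∖⁺ {P = between i≢j} (mem (fromWitness l∈ij)) l≢k))

    -- A point of Q on a bichromatic segment cuts off a shorter bichromatic segment.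
    blocked-if-shorter : ∀ {i j} (i≢j : i ≢ j) → ShorterBlocked (count (between i≢j)) →
      i ∈ Q → j ∈ Q → col i ≢ col j → Blocked i j
    blocked-if-shorter {i} {j} i≢j shorter i∈Q j∈Q ci≢cj = by-visibility (visible? i≢j)
      where
      by-colour : ∀ {k} → Between i j k → k ∈ Q → Dec (col i ≡ col k) → Blocked i j
      by-colour {k} k∈ij k∈Q (no ci≢ck) = let l , l∈C , l∈ik = shorter i≢k smaller i∈Q k∈Q ci≢ck in
        l , l∈C , between-trans k∈ij l∈ik
        where
        i≢k : i ≢ k
        i≢k = between-≢ˡ i≢j k∈ij ∘ sym
        smaller : count (between i≢k) ℕ.< count (between i≢j)
        smaller = between-shorter i≢j i≢k k∈ij λ l∈ik → between-trans k∈ij l∈ik , between-≢ʳ i≢k l∈ik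
      by-colour {k} k∈ij k∈Q (yes ci≡ck) = let l , l∈C , l∈kj = shorter k≢j smaller k∈Q j∈Q (ci≢cj ∘ trans ci≡ck) in
        l , l∈C , within l∈kj
        where
        k≢j : k ≢ j
        k≢j = between-≢ʳ i≢j k∈ij
        within : ∀ {l} → Between k j l → Between i j l
        within l∈kj = between-sym (between-trans (between-sym k∈ij) (between-sym l∈kj))
        smaller : count (between k≢j) ℕ.< count (between i≢j)
        smaller = between-shorter i≢j k≢j k∈ij λ l∈kj → within l∈kj , between-≢ˡ k≢j l∈kj
      by-membership : ∀ {k} → Between i j k → Dec (k ∈ C) → Blocked i j
      by-membership k∈ij (yes k∈C) = _ , k∈C , k∈ij
      by-membership k∈ij (no  k∉C) = by-colour k∈ij (∁⁺ k∉C) (col i Bool.≟ col _)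
      by-visibility : Visible i j ⊎ (∃[ k ] Between i j k) → Blocked i j
      by-visibility (inj₁ visible) = contradiction (i≢j , visible) (separated i∈Q j∈Q ci≢cj)
      by-visibility (inj₂ (k , k∈ij)) = by-membership k∈ij (k ∈? C)

    shorter-blocked : ∀ m → ShorterBlocked m
    shorter-blocked (suc m) i≢j <m = blocked-if-shorter i≢j λ i′≢j′ < → shorter-blocked m i′≢j′ (ℕ.<-≤-trans < (ℕ.s≤s⁻¹ <m))

    blocks : Blocks Q C
    blocks i∈Q j∈Q ci≢cj = shorter-blocked _ (λ { refl → ci≢cj refl }) (ℕ.n<1+n _) i∈Q j∈Q ci≢cj

    module _ {δ : ℕ} (degree : MinDegree≥ δ) where

      -- A vertex of Q sees only its own colour and the separator.
      degree-bound : ∀ {v} → v ∈ Q → suc δ ℕ.≤ # (col v) on Q ℕ.+ count C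
      degree-bound {v} v∈Q with degree v
      -- The `suc` accounts for v, which has its own colour but is not its own neighbour.
      ... | f , f-inj , adj = subst (suc δ ℕ.≤_) (cong (ℕ._+ count C) (sym (count-∖ v∈own)))
              (s≤s (begin
                δ                                                   ≡⟨ sym (count-full δ) ⟩
                count (full {δ})                                    ≤⟨ pigeonhole full seen (λ r j → f r ≡ j)
                                                                         (λ r _ → f r , sees r , refl)
                                                                         (λ _ _ eq eq′ → f-inj (trans eq (sym eq′))) ⟩
                count seen                                          ≡⟨ count-split seen C ⟩
                count (seen ∩ C) ℕ.+ count (seen ∩ ∁ C)             ≤⟨ ℕ.+-mono-≤ (count-⊆ (λ i → proj₂ ∘ ∩⁻ {P = seen})) (count-⊆ own⊆) ⟩
                count C ℕ.+ count (own ∖ v)                         ≡⟨ ℕ.+-comm (count C) _ ⟩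
                count (own ∖ v) ℕ.+ count C                         ∎))
        where
        open ℕ.≤-Reasoning
        own = Q ∩ coloured (col v)
        other = Q ∩ ∁ (coloured (col v))
        seen = ∁ other ∖ v
        v∈own : v ∈ own
        v∈own = ∩⁺ {P = Q} v∈Q (coloured⁺ refl)
        sees : ∀ r → f r ∈ seen
        sees r = ∖⁺ {P = ∁ other} (∁⁺ λ fr∈ → separated v∈Q (proj₁ (∩⁻ {P = Q} fr∈))
          (λ eq → ∁⁻ (proj₂ (∩⁻ {P = Q} fr∈)) (coloured⁺ (sym eq))) (adj r)) (λ eq → proj₁ (adj r) (sym eq))
        own⊆ : seen ∩ ∁ C ⊆ own ∖ v
        own⊆ i i∈ with ∩⁻ {P = seen} i∈
        ... | i∈seen , i∈Q with ∖⁻ {P = ∁ other} i∈seen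
        ...   | i∉other , i≢v with i ∈? coloured (col v)
        ...     | yes i∈own = ∖⁺ {P = own} (∩⁺ {P = Q} i∈Q i∈own) i≢v
        ...     | no  i∉own = contradiction (∩⁺ {P = Q} i∈Q (∁⁺ i∉own)) (∁⁻ i∉other)

      bound-noncollinear : ¬ Collinear Q → (∀ c → 1 ℕ.≤ # c on Q) → suc (suc δ) ℕ.≤ count C ℕ.+ count C
      bound-noncollinear ¬col both = by-size (ℕ.≤-total (# true on Q) (# false on Q))
        where
        at-minority : ∀ c → # c on Q ℕ.≤ # (not c) on Q → ∃[ v ] v ∈ Q × col v ≡ c → suc (suc δ) ℕ.≤ count C ℕ.+ count C
        -- With m points of colour c, the degree bound reads δ + 1 ≤ m + |C| and the lower bound on
        -- blockers m + 1 ≤ |C|.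
        at-minority c c≤c̄ (v , v∈Q , refl) = ℕ.≤-trans (s≤s (degree-bound v∈Q))
          (ℕ.+-monoˡ-≤ (count C) (needs-suc (count Q) ℕ.≤-refl (both c) k≤# ¬col C blocks))
          where
          k≤# : ∀ c′ → # c on Q ℕ.≤ # c′ on Q
          k≤# c′ with c Bool.≟ c′
          ... | yes refl = ℕ.≤-refl
          ... | no c≢c′  = subst (λ c′ → # c on Q ℕ.≤ # c′ on Q) (sym (Bool.¬-not (c≢c′ ∘ sym))) c≤c̄
        by-size : # true on Q ℕ.≤ # false on Q ⊎ # false on Q ℕ.≤ # true on Q → suc (suc δ) ℕ.≤ count C ℕ.+ count C
        by-size (inj₁ ≤) = at-minority true ≤ (#-pos⇒∈ {Q} true (both true))
        by-size (inj₂ ≤) = at-minority false ≤ (#-pos⇒∈ {Q} false (both false))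

      -- The lowest point v of Q on the line sees at most one other point of Q, and if so
      -- it does not see the blocker between v and a point of the other colour.
      bound-collinear : ¬ Collinear full → Collinear Q → (∀ c → 1 ℕ.≤ # c on Q) → suc (suc δ) ℕ.≤ count C ℕ.+ count C
      bound-collinear ¬col (ℓ , nd , ℓ≡0) both = from-lowest (argmin Q (height at_) nonempty)
        where
        nonempty : ∃[ i ] i ∈ Q
        nonempty with #-pos⇒∈ {Q} true (both true)
        ... | i , i∈Q , _ = i , i∈Q
        from-lowest : ∃[ v ] v ∈ Q × (∀ i → i ∈ Q → height at v ≤ᵣ height at i) → suc (suc δ) ℕ.≤ count C ℕ.+ count C
        from-lowest (v , v∈Q , lowest) with #-pos⇒∈ {Q} (not (col v)) (both (not (col v)))
        ... | u , u∈Q , cu with blocks v∈Q u∈Q (λ eq → Bool.not-¬ {col v} refl (trans eq cu)) | degree v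
        ...   | b , b∈C , b∈vu | f , f-inj , adj = ℕ.+-mono-≤ {2} 2≤|C| δ≤|C|
          where
          v<Q : ∀ {i} → i ∈ Q → v ≢ i → height at v <ᵣ height at i
          v<Q i∈Q v≢i = ≤∧≢⇒< (lowest _ i∈Q) (v≢i ∘ height-injective)
          v≢u : v ≢ u
          v≢u refl = Bool.not-¬ {col v} refl cu
          ℓb≡0 : ℓ at b ≡ 0ᵣ
          ℓb≡0 = between-0 ℓ b∈vu (ℓ≡0 v v∈Q) (ℓ≡0 u u∈Q)
          v<b : height at v <ᵣ height at b
          v<b = above-pos⁻ (between-0-pos (above v) b∈vu (above-self v) (above-pos (v<Q u∈Q v≢u)))
          unique : ∀ {i j} → ℓ at i ≡ 0ᵣ → ℓ at j ≡ 0ᵣ → height at v <ᵣ height at i → height at v <ᵣ height at j →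
            Visible v i → Visible v j → i ≡ j
          unique {i} {j} ℓi ℓj v<i v<j visᵢ visⱼ with compare (height at i) (height at j)
          ... | tri≈ _ eq _ = height-injective eq
          ... | tri< i<j _ _ = contradiction (i , between-on-line ℓ nd (ℓ≡0 v v∈Q) ℓi ℓj v<i i<j) visⱼ
          ... | tri> _ _ j<i = contradiction (j , between-on-line ℓ nd (ℓ≡0 v v∈Q) ℓj ℓi v<j j<i) visᵢ
          unique-in-Q : ∀ {i j} → i ∈ Q → ℓ at j ≡ 0ᵣ → height at v <ᵣ height at j → Adj v i → Adj v j → i ≡ j
          unique-in-Q i∈Q ℓj v<j (v≢i , visᵢ) (_ , visⱼ) = unique (ℓ≡0 _ i∈Q) ℓj (v<Q i∈Q v≢i) v<j visᵢ visⱼ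
          -- Neighbours in C are assigned to themselves and a neighbour in Q to b. Nothing collides:
          -- of the points of ℓ above v only one is visible from v, so v cannot have two neighbours
          -- in Q, nor both b and a point of Q.
          Assigned : Fin δ → Fin n → Set
          Assigned r j = (f r ∈ C × f r ≡ j) ⊎ (f r ∈ Q × b ≡ j)
          assign : ∀ r → r ∈ full → ∃[ j ] j ∈ C × Assigned r j
          assign r _ with f r ∈? C
          ... | yes fr∈C = f r , fr∈C , inj₁ (fr∈C , refl)
          ... | no  fr∉C = b , b∈C , inj₂ (∁⁺ fr∉C , refl)
          mixed : ∀ {r r′} → f r ∈ C → f r ≡ b → f r′ ∈ Q → f r′ ≡ f r
          mixed {r} {r′} fr∈C fr≡b fr′∈Q = trans (unique-in-Q fr′∈Q ℓb≡0 v<b (adj r′) (subst (Adj v) fr≡b (adj r))) (sym fr≡b)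
          assigned-inj : ∀ {r r′ j} → r ∈ full → r′ ∈ full → Assigned r j → Assigned r′ j → r ≡ r′
          assigned-inj _ _ (inj₁ (_ , eq)) (inj₁ (_ , eq′)) = f-inj (trans eq (sym eq′))
          assigned-inj _ _ (inj₁ (fr∈C , eq)) (inj₂ (fr′∈Q , eq′)) = f-inj (sym (mixed fr∈C (trans eq (sym eq′)) fr′∈Q))
          assigned-inj _ _ (inj₂ (fr∈Q , eq)) (inj₁ (fr′∈C , eq′)) = f-inj (mixed fr′∈C (trans eq′ (sym eq)) fr∈Q)
          assigned-inj {r} {r′} _ _ (inj₂ (fr∈Q , _)) (inj₂ (fr′∈Q , _)) =
            f-inj (unique-in-Q fr∈Q (ℓ≡0 _ fr′∈Q) (v<Q fr′∈Q (proj₁ (adj r′))) (adj r) (adj r′))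
          δ≤|C| : δ ℕ.≤ count C
          δ≤|C| = subst (ℕ._≤ count C) (count-full δ) (pigeonhole full C Assigned assign assigned-inj)
          -- The blocker b is on ℓ. A point off ℓ exists because the whole set is not collinear, and
          -- it belongs to C because Q is on ℓ.
          2≤|C| : 2 ℕ.≤ count C
          2≤|C| with off-line-point ℓ ¬col nd
          ... | w , _ , ℓw≢0 = subst (2 ℕ.≤_) (sym (count-split C (kernel ℓ))) (ℕ.+-mono-≤ {1}
                  (∈⇒0<count {P = C ∩ kernel ℓ} (∩⁺ {P = C} b∈C (kernel⁺ {ℓ} ℓb≡0)))
                  (∈⇒0<count {P = C ∩ ∁ (kernel ℓ)} (∩⁺ {P = C} w∈C (∁⁺ (ℓw≢0 ∘ kernel⁻ {ℓ})))))
            where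
            w∈C : w ∈ C
            w∈C with w ∈? C
            ... | yes w∈C = w∈C
            ... | no  w∉C = contradiction (ℓ≡0 w (∁⁺ w∉C)) ℓw≢0

      separator-bound : ¬ Collinear full → (∀ c → 1 ℕ.≤ # c on Q) → suc (suc δ) ℕ.≤ count C ℕ.+ count C
      separator-bound ¬col both with collinear? Q
      ... | yes colQ = bound-collinear ¬col colQ both
      ... | no ¬colQ = bound-noncollinear ¬colQ both

theorem11 : (R : RealField) (n : ℕ) (p : Fin n → Plane.Point R) →
    Injective _≡_ _≡_ p →
    ¬ Plane.PointSet.Collinear R p → (δ : ℕ) → Plane.PointSet.MinDegree≥ R p δ →
    Plane.PointSet.ConnectivityAtLeastHalfPlusOne R p δ
theorem11 R n p p-inj ¬collinear δ degree = κ , δ+2≤2κ , κ<n , connected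
  where
  open Geometry R p p-inj
  open Plane.PointSet R p hiding (Collinear)
  open Visibility R p p-inj

  ¬col : ¬ Collinear full
  ¬col (form a b c , nd , on-line) = ¬collinear (a , b , -ᵣ c , nd , λ i →
    trans (solve 2 (λ u c → u := (u :+ c) :+ :- c) refl (a · x i + b · y i) c) (trans (cong (_+ -ᵣ c) (on-line i _)) (+-identityˡ _)))

  -- If |S| < κ then 2 |S| ≤ 2 ⌈δ/2⌉ ≤ δ + 1, one short of the δ + 2 that a separator must reach.
  h κ : ℕ
  h = ℕ.⌈ δ /2⌉
  κ = suc h

  δ+2≤2κ : δ ℕ.+ 2 ℕ.≤ 2 ℕ.* κ
  δ+2≤2κ = begin
    δ ℕ.+ 2               ≡⟨ ℕ.+-comm δ 2 ⟩
    suc (suc δ)           ≤⟨ s≤s (s≤s (n≤2*⌈n/2⌉ δ)) ⟩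
    suc (suc (h ℕ.+ h))   ≡⟨ cong suc (sym (ℕ.+-suc h h)) ⟩
    κ ℕ.+ κ               ≡⟨ cong (κ ℕ.+_) (sym (ℕ.+-identityʳ κ)) ⟩
    2 ℕ.* κ               ∎
    where open ℕ.≤-Reasoning

  κ<n : κ ℕ.< n
  κ<n = 1+⌈n/2⌉<m δ (3≤n ¬col) (degree<n degree ¬col)

  connected : ∀ S → Subset.∣ S ∣ ℕ.< κ → ConnectedAvoiding S
  connected S |S|<κ s t s∉S t∉S = from-component (component n (∁ ⁅ t ⁆) count≤n (λ t∈ → ∁⁻ t∈ (⁅⁆⁺ refl)) reaching)
    where
    open Component S t∉S
    count≤n : count (∁ ⁅ t ⁆) ℕ.≤ n
    count≤n = subst (count (∁ ⁅ t ⁆) ℕ.≤_) (count-full n) (count-⊆ {P = ∁ ⁅ t ⁆} {full} λ _ _ → _)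
    reaching : Reaching (∁ ⁅ t ⁆)
    reaching i i∉ with i Fin.≟ t
    ... | yes refl = t∉S , here
    ... | no  i≢t  = contradiction (∁⁺ (i≢t ∘ ⁅⁆⁻)) i∉
    from-component : ∃[ U ] ¬ t ∈ U × Reaching U × Closed U → WalkAvoiding S s t
    from-component (U , t∉U , reach , closed) with s ∈? U
    ... | no  s∉U = proj₂ (reach s s∉U)
    ... | yes s∈U = contradiction too-small (ℕ.<⇒≱ (s≤s (begin
      count C ℕ.+ count C ≤⟨ ℕ.+-mono-≤ |C|≤h |C|≤h ⟩
      h ℕ.+ h             ≤⟨ 2*⌈n/2⌉≤1+n δ ⟩
      suc δ               ∎)))
      where
      open ℕ.≤-Reasoning
      C : FinSet n
      C = lookup S
      -- Membership in U is the colouring: s is on the unreached side and t on the other, and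
      -- `closed` forbids adjacency between the colours outside S.
      open Separator R p p-inj U C
      open Blocking R p p-inj U using (#_on_; coloured; coloured⁺)
      |C|≤h : count C ℕ.≤ h
      |C|≤h = subst (ℕ._≤ h) (∣∣≡count S) (ℕ.s≤s⁻¹ |S|<κ)
      ∉S : ∀ {i} → i ∈ Q → i Subset.∉ S
      ∉S i∈Q = ∁⁻ i∈Q ∘ ∈-subset⁻
      unreached : ∀ {i} → U i ≡ true → i ∈ U
      unreached eq = mem (subst T (sym eq) _)
      reached : ∀ {i} → U i ≡ false → ¬ i ∈ U
      reached eq (mem i∈U) = subst T eq i∈U
      adj-sym : ∀ {i j} → Adj i j → Adj j i
      adj-sym (i≢j , visible) = i≢j ∘ sym , λ (k , k∈ji) → visible (k , between-sym k∈ji)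
      separated : ∀ {i j} → i ∈ Q → j ∈ Q → U i ≢ U j → ¬ Adj i j
      separated {i} {j} i∈Q j∈Q ci≢cj adj with U i in ci | U j in cj
      ... | true  | true  = ci≢cj refl
      ... | false | false = ci≢cj refl
      ... | true  | false = closed i j (unreached ci) (∉S i∈Q) (reached cj) adj
      ... | false | true  = closed j i (unreached cj) (∉S j∈Q) (reached ci) (adj-sym adj)
      both : ∀ c → 1 ℕ.≤ # c on Q
      both true  = ∈⇒0<count {P = Q ∩ coloured true} {s} (∩⁺ {P = Q} (∁⁺ (s∉S ∘ ∈-subset⁺)) (coloured⁺ (Equivalence.to Bool.T-≡ (holds s∈U))))
      both false = ∈⇒0<count {P = Q ∩ coloured false} {t} (∩⁺ {P = Q} (∁⁺ (t∉S ∘ ∈-subset⁺)) (coloured⁺ (Bool.¬-not λ eq → t∉U (unreached eq))))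
      too-small : suc (suc δ) ℕ.≤ count C ℕ.+ count C
      too-small = separator-bound separated degree ¬col both
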